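{- Let $n\ge 0$ be an integer that is not a triangular number, i.e. not of the form $k(k+1)/2$ with $k\ge 0$ an integer. Then for all integers $\alpha\ge 0$, $\beta\ge 0$ and every prime $p\ge 3$, $$v_0(2^{2\alpha+2}p^{2\beta}(8n+1))\equiv 0 \pmod{2^{3\alpha+9}}.$$
   Context: The integer sequence $v_0(n)$, $n\ge 0$, is defined by the generating function (formal power series in $q$) $$\sum_{n=0}^\infty v_0(n)q^n=\sum_{n=0}^\infty \frac{q^{n^2}(-q;q^2)_n}{(q;q^2)_n},$$ where $(a;q)_0=1$ and $(a;q)_n=\prod_{i=1}^n(1-aq^{i-1})$ for $n\ge1$, so that $(-q;q^2)_n=\prod_{i=1}^n(1+q^{2i-1})$ and $(q;q^2)_n=\prod_{i=1}^n(1-q^{2i-1})$. -}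

module Defs where

open import Data.Fin.Base using (Fin; zero; suc; toℕ)
open import Data.Fin.Properties using (toℕ<n)
open import Data.Integer.Base as ℤ using (ℤ; 0ℤ; 1ℤ)
open import Data.Integer.Properties as ℤ using (+-0-commutativeMonoid)
open import Data.Nat.Base as ℕ using (ℕ; zero; suc; _∸_; _<_; _≤_; z≤n; s≤s)
import Data.Nat.Properties as ℕ
open import Data.Vec.Base using (Vec; []; _∷_; head; lookup)
open import Algebra.Properties.CommutativeMonoid.Sum +-0-commutativeMonoid
  using (sum-syntax; sum⁺-syntax; sum-cong-≗; sum-replicate-zero)
open import Relation.Nullary using (yes; no)
open import Relation.Binary.PropositionalEquality

infixl 6 _⊖_
infixl 7 _⊛_
infixr 8 _^_ ⊝_
infixr 9 _⁻¹

-- Formal power series in q over ℤ; f n is the coefficient of qⁿ.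
Series : Set
Series = ℕ → ℤ

1# : Series
1# zero    = 1ℤ
1# (suc _) = 0ℤ

q : Series
q 1 = 1ℤ
q _ = 0ℤ

_⊖_ _⊛_ : Series → Series → Series
(f ⊖ g) n = f n ℤ.- g n
(f ⊛ g) n = ∑[ i ≤ n ] (f (toℕ i) ℤ.* g (n ∸ toℕ i))

⊝_ : Series → Series
(⊝ f) n = ℤ.- f n

_^_ : Series → ℕ → Series
f ^ zero  = 1#
f ^ suc n = f ⊛ f ^ n

-- The inverse g of a series f with constant term 1, from the recurrence
-- g n = [n = 0] − Σ_{i<n} f (i+1) g (n−1−i).  If the constant term of f is
-- not 1 the result is junk; see ⁻¹-inverse and pochhammer-q-const below.
-- inverseCoeffs f n is the vector g (n−1), …, g 0.
inverseCoeffs : Series → (n : ℕ) → Vec ℤ n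
inverseCoeffs f zero    = []
inverseCoeffs f (suc n) =
  let gs = inverseCoeffs f n in
  (1# n ℤ.- ∑[ i < n ] (f (suc (toℕ i)) ℤ.* lookup gs i)) ∷ gs

_⁻¹ : Series → Series
(f ⁻¹) n = head (inverseCoeffs f (suc n))

-- (a ; b)_n = ∏_{i=1}^n (1 − a b^{i−1})
pochhammer : Series → Series → ℕ → Series
pochhammer a b zero    = 1#
pochhammer a b (suc n) = pochhammer a b n ⊛ (1# ⊖ a ⊛ b ^ n)

-- Σ_{k≥0} f k for families in which f k has no terms of degree below k, so
-- that only k ≤ n contribute to the coefficient of qⁿ; see v₀-summand-order.
∑∞ : (ℕ → Series) → Series
∑∞ f n = ∑[ k ≤ n ] f (toℕ k) n

v₀-summand : ℕ → Series
v₀-summand n =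
  q ^ (n ℕ.* n) ⊛ pochhammer (⊝ q) (q ^ 2) n ⊛ (pochhammer q (q ^ 2) n) ⁻¹

v₀ : ℕ → ℤ
v₀ = ∑∞ v₀-summand

-- The remaining lemmas justify the uses of _⁻¹ and ∑∞ in v₀.

private
  ∑-zero : ∀ n {t : Fin n → ℤ} → (∀ i → t i ≡ 0ℤ) → ∑[ i < n ] t i ≡ 0ℤ
  ∑-zero n t≡0 = trans (sum-cong-≗ t≡0) (sum-replicate-zero n)

  lookup-inverseCoeffs : ∀ f n (i : Fin (suc n)) →
    lookup (inverseCoeffs f (suc n)) i ≡ (f ⁻¹) (n ∸ toℕ i)
  lookup-inverseCoeffs f n       zero    = refl
  lookup-inverseCoeffs f (suc n) (suc i) = lookup-inverseCoeffs f n i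

⁻¹-inverse : ∀ f → f 0 ≡ 1ℤ → f ⊛ f ⁻¹ ≗ 1#
⁻¹-inverse f f₀≡1 zero rewrite f₀≡1 = refl
⁻¹-inverse f f₀≡1 (suc n) = begin
  f 0 ℤ.* (0ℤ ℤ.- s) ℤ.+ t    ≡⟨ cong (λ c → c ℤ.* (0ℤ ℤ.- s) ℤ.+ t) f₀≡1 ⟩
  1ℤ ℤ.* (0ℤ ℤ.- s) ℤ.+ t     ≡⟨ cong (ℤ._+ t) (ℤ.*-identityˡ (0ℤ ℤ.- s)) ⟩
  (0ℤ ℤ.- s) ℤ.+ t            ≡⟨ cong (ℤ._+ t) (ℤ.+-identityˡ (ℤ.- s)) ⟩
  (ℤ.- s) ℤ.+ t               ≡⟨ cong (λ z → ℤ.- z ℤ.+ t) s≡t ⟩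
  (ℤ.- t) ℤ.+ t               ≡⟨ ℤ.+-inverseˡ t ⟩
  0ℤ                          ∎
  where
  open ≡-Reasoning
  s = ∑[ i ≤ n ] (f (suc (toℕ i)) ℤ.* lookup (inverseCoeffs f (suc n)) i)
  t = ∑[ i ≤ n ] (f (suc (toℕ i)) ℤ.* (f ⁻¹) (n ∸ toℕ i))
  s≡t : s ≡ t
  s≡t = sum-cong-≗ λ i →
    cong (f (suc (toℕ i)) ℤ.*_) (lookup-inverseCoeffs f n i)

pochhammer-q-const : ∀ b n → pochhammer q b n 0 ≡ 1ℤ
pochhammer-q-const b zero = refl
pochhammer-q-const b (suc n) rewrite pochhammer-q-const b n = refl

Order≥ : ℕ → Series → Set
Order≥ m f = ∀ n → n < m → f n ≡ 0ℤ

⊛-order : ∀ {k m} f g → Order≥ k f → Order≥ m g → Order≥ (k ℕ.+ m) (f ⊛ g)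
⊛-order {k} {m} f g fo go n n<k+m = ∑-zero (suc n) term
  where
  term : ∀ (i : Fin (suc n)) → f (toℕ i) ℤ.* g (n ∸ toℕ i) ≡ 0ℤ
  term i with toℕ i ℕ.<? k
  ... | yes i<k rewrite fo (toℕ i) i<k = refl
  ... | no  i≮k = trans (cong (f (toℕ i) ℤ.*_) (go (n ∸ toℕ i) n∸i<m))
                        (ℤ.*-zeroʳ (f (toℕ i)))
    where
    n∸i<m : n ∸ toℕ i < m
    n∸i<m = ℕ.+-cancelˡ-< (toℕ i) _ _ (subst (_< toℕ i ℕ.+ m)
      (sym (ℕ.m+[n∸m]≡n (ℕ.≤-pred (toℕ<n i))))
      (ℕ.<-≤-trans n<k+m (ℕ.+-monoˡ-≤ m (ℕ.≮⇒≥ i≮k))))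

⊛-orderˡ : ∀ {k} f g → Order≥ k f → Order≥ k (f ⊛ g)
⊛-orderˡ {k} f g fo =
  subst (λ m → Order≥ m (f ⊛ g)) (ℕ.+-identityʳ k) (⊛-order f g fo (λ _ ()))

q^-order : ∀ m → Order≥ m (q ^ m)
q^-order zero    = λ _ ()
q^-order (suc m) = ⊛-order q (q ^ m) q-order (q^-order m)
  where
  q-order : Order≥ 1 q
  q-order zero _ = refl
  q-order (suc _) (s≤s ())

v₀-summand-order : ∀ k → Order≥ k (v₀-summand k)
v₀-summand-order k n n<k =
  ⊛-orderˡ (a ⊛ b) c (⊛-orderˡ a b (q^-order (k ℕ.* k))) n
    (ℕ.<-≤-trans n<k (k≤k² k))
  where
  a = q ^ (k ℕ.* k)
  b = pochhammer (⊝ q) (q ^ 2) k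
  c = (pochhammer q (q ^ 2) k) ⁻¹
  k≤k² : ∀ k → k ≤ k ℕ.* k
  k≤k² zero    = z≤n
  k≤k² (suc k) = ℕ.m≤m*n (suc k) (suc k)

{-# OPTIONS --safe #-}
module Submission where

open import Defs using (v₀)
open import Data.Nat using (ℕ; _+_; _*_; _^_; _≤_; _/_)
open import Data.Nat.Primality using (Prime)
open import Data.Integer using (+_)
open import Data.Integer.Divisibility using (_∣_)
open import Data.Product using (∃-syntax)
open import Relation.Nullary using (¬_)
open import Relation.Binary.PropositionalEquality using (_≡_)

open import Defs using (Series; q)
import Defs as D
open import Algebra.Bundles using (CommutativeRing)
import Algebra.Solver.Ring
open import Algebra.Solver.Ring.AlmostCommutativeRing
  using (fromCommutativeRing; _-Raw-AlmostCommutative⟶_)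
open import Algebra.Structures using (IsAbelianGroup)
open import Data.Empty using (⊥-elim)
open import Data.Fin.Base using (toℕ)
open import Data.Integer as ℤ using (ℤ; 0ℤ; 1ℤ; -1ℤ)
import Data.Integer.Properties as ℤ
open import Algebra.Properties.CommutativeMonoid.Sum ℤ.+-0-commutativeMonoid using (sum-syntax)
open import Data.Integer.Solver using (module +-*-Solver)
open import Data.Maybe using (Maybe; just; nothing)
open import Data.Nat using (zero; suc; _<_; z≤n; s≤s; NonZero)
open import Data.Nat.Divisibility as ℕ using (divides; divides-refl)
open import Data.Nat.DivMod using (m*n/n≡m)
open import Data.Nat.Primality using (euclidsLemma; prime⇒irreducible; prime⇒nonZero)
import Data.Nat.Properties as ℕ
import Data.Nat.Tactic.RingSolver as ℕ-Solver
open import Data.Product using (_,_; _×_)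
open import Data.Sum using (_⊎_; inj₁; inj₂)
open import Level using (0ℓ)
open import Relation.Binary.Bundles using (Setoid)
open import Relation.Binary.Definitions using (tri<; tri≈; tri>)
open import Relation.Binary.PropositionalEquality
  using (_≢_; refl; sym; trans; cong; cong₂; subst; module ≡-Reasoning)
import Relation.Binary.Reasoning.Setoid as SetoidReasoning
open import Relation.Binary.Structures using (IsEquivalence)
open import Relation.Nullary using (yes; no; Dec)

-- Let U f = Σ f(2n) qⁿ.  The bilateral sum obtained from v₀(q) + v₀(−q) is
-- well-poised: it is B(q) for a family B(z) whose terms telescope under
-- z ↦ z q².  Iterating gives B(q) as a product times lim B(z) = φ(q²), while
-- a second family of the same shape gives Gauss' product for φ(−q).  Hence
-- 2 Σ v₀(2n) qⁿ − 1 = φ(q)²/φ(−q²) and φ(q) φ(−q) = φ(−q²)².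
--
-- Put S = φ(q)⁴/φ(−q)⁴ − 1, which is divisible by 16.  The operator U² maps
-- φ(q) S ℤ[S] into 8 φ(q) S ℤ[S], so that applying it α ≥ 1 times to
-- 2 Σ v₀(4n) qⁿ − 1 gives φ(q) (1 + 2^(3α−1) S P(S)) with P ∈ ℤ[S].
-- Extracting the exponents 8n + 1 from φ(q) S P(S) gives a multiple of
-- ψ(q) = Σ q^(k(k+1)/2) modulo 2^11, and ψ is supported on triangular numbers.

-- Ring structure on ℤ[[q]], exact and modulo q^N

-- Both families are one sum with parameters a, b, z and a² = 1: a = -1, b = q² gives v₀ at z = q,
-- and a = 1, b = q gives φ(-q) as z → 0. No infinite product is formed: each family obeys a
-- first-order recurrence in z, and suitable products of its values obey the same recurrence, so
-- they are compared at the start and in the limit, always modulo q^N. In the second half the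
-- obstacle is the denominator φ(-q), on whose quotients U has no simple action. By φ(q) φ(-q) =
-- φ(-q²)² it can be traded for an even one, and even factors pass through U. Odd parts involve G,
-- but q G² = S (1 + S), so ℤ[S] is stable and only powers of 2 have to be counted: 2^(3α-1) · 2^11
-- = 2^(3α+10) for α ≥ 1, and 2^10 directly for α = 0. The series carries 2 v₀, which leaves
-- 2^(3α+9). The prime enters at the end: p² ≡ 1 modulo 8, and p² times a non-square is a
-- non-square, so p^(2β) (8n + 1) is 8n′ + 1 with n′ again not triangular.

infixl 6 _⊕_ _⊖_
infixl 7 _⊛_
infixr 8 ⊝_
infix 4 _≈_ _≈[_]_

-- Opaque, so that unification does not unfold the coefficients.
opaque
  _⊕_ _⊛_ : Series → Series → Series
  (f ⊕ g) n = f n ℤ.+ g n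
  f ⊛ g = f D.⊛ g

  ⊝_ : Series → Series
  ⊝ f = D.⊝ f

  const : ℤ → Series
  const c zero    = c
  const c (suc _) = 0ℤ

  0# : Series
  0# _ = 0ℤ

_⊖_ : Series → Series → Series
f ⊖ g = f ⊕ ⊝ g

1# : Series
1# = const 1ℤ

tail : Series → Series
tail f n = f (suc n)

record _≈_ (f g : Series) : Set where
  constructor agree
  field coeff : ∀ n → f n ≡ g n
open _≈_

-- Congruence modulo q^N. Infinite sums and limits enter only as truncations valid to a given order;
-- `≈[]⇒≈` recovers the exact identity.
record _≈[_]_ (f : Series) (N : ℕ) (g : Series) : Set where
  constructor agree
  field coeff : ∀ n → n < N → f n ≡ g n
open _≈[_]_ renaming (coeff to coeff<)

≈⇒≈[] : ∀ {N f g} → f ≈ g → f ≈[ N ] g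
≈⇒≈[] f≈g = agree λ n _ → coeff f≈g n

≈[]⇒≈ : ∀ {f g} → (∀ N → f ≈[ N ] g) → f ≈ g
≈[]⇒≈ f≈g = agree λ n → coeff< (f≈g (suc n)) n (ℕ.n<1+n n)

≈[]-weaken : ∀ {M N f g} → M ≤ N → f ≈[ N ] g → f ≈[ M ] g
≈[]-weaken M≤N f≈g = agree λ n n<M → coeff< f≈g n (ℕ.<-≤-trans n<M M≤N)

≈-isEquivalence : IsEquivalence _≈_
≈-isEquivalence = record
  { refl  = agree λ _ → refl
  ; sym   = λ f≈g → agree λ n → sym (coeff f≈g n)
  ; trans = λ f≈g g≈h → agree λ n → trans (coeff f≈g n) (coeff g≈h n)
  }

≈[]-setoid : ℕ → Setoid 0ℓ 0ℓ
≈[]-setoid N = record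
  { Carrier = Series
  ; _≈_     = _≈[ N ]_
  ; isEquivalence = record
    { refl  = agree λ _ _ → refl
    ; sym   = λ f≈g → agree λ n n<N → sym (coeff< f≈g n n<N)
    ; trans = λ f≈g g≈h → agree λ n n<N → trans (coeff< f≈g n n<N) (coeff< g≈h n n<N)
    }
  }

module _ {N : ℕ} where
  open Setoid (≈[]-setoid N) public using ()
    renaming (refl to ≈[]-refl; sym to ≈[]-sym; trans to ≈[]-trans)

opaque
  unfolding _⊕_

  ⊛-cong-pointwise : ∀ n {f f′ g g′ : Series} → (∀ i → i ≤ n → f i ≡ f′ i) →
    (∀ i → i ≤ n → g i ≡ g′ i) → (f ⊛ g) n ≡ (f′ ⊛ g′) n
  ⊛-cong-pointwise zero ff gg =
    cong (ℤ._+ 0ℤ) (cong₂ ℤ._*_ (ff 0 z≤n) (gg 0 z≤n))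
  ⊛-cong-pointwise (suc n) ff gg =
    cong₂ ℤ._+_ (cong₂ ℤ._*_ (ff 0 z≤n) (gg (suc n) ℕ.≤-refl))
      (⊛-cong-pointwise n (λ i i≤n → ff (suc i) (s≤s i≤n)) (λ i i≤n → gg i (ℕ.m≤n⇒m≤1+n i≤n)))

  ⊛-cong[] : ∀ {N f f′ g g′} → f ≈[ N ] f′ → g ≈[ N ] g′ → f ⊛ g ≈[ N ] f′ ⊛ g′
  ⊛-cong[] ff gg = agree λ n n<N → ⊛-cong-pointwise n
    (λ i i≤n → coeff< ff i (ℕ.≤-<-trans i≤n n<N)) (λ i i≤n → coeff< gg i (ℕ.≤-<-trans i≤n n<N))

  ⊕-cong[] : ∀ {N f f′ g g′} → f ≈[ N ] f′ → g ≈[ N ] g′ → f ⊕ g ≈[ N ] f′ ⊕ g′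
  ⊕-cong[] ff gg = agree λ n n<N → cong₂ ℤ._+_ (coeff< ff n n<N) (coeff< gg n n<N)

  ⊛-distribʳ : ∀ f g h n → ((f ⊕ g) ⊛ h) n ≡ (f ⊛ h) n ℤ.+ (g ⊛ h) n
  ⊛-distribʳ f g h zero = solve 3 (λ a b c →
    (a :+ b) :* c :+ con 0ℤ := (a :* c :+ con 0ℤ) :+ (b :* c :+ con 0ℤ)) refl (f 0) (g 0) (h 0)
    where open +-*-Solver
  ⊛-distribʳ f g h (suc n) rewrite ⊛-distribʳ (tail f) (tail g) h n = solve 5 (λ a b c x y →
    (a :+ b) :* c :+ (x :+ y) := (a :* c :+ x) :+ (b :* c :+ y)) refl
    (f 0) (g 0) (h (suc n)) ((tail f ⊛ h) n) ((tail g ⊛ h) n)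
    where open +-*-Solver

  ⊛-scaleˡ : ∀ c f g n → ((λ i → c ℤ.* f i) ⊛ g) n ≡ c ℤ.* (f ⊛ g) n
  ⊛-scaleˡ c f g zero = solve 3 (λ c a b →
    c :* a :* b :+ con 0ℤ := c :* (a :* b :+ con 0ℤ)) refl c (f 0) (g 0)
    where open +-*-Solver
  ⊛-scaleˡ c f g (suc n) rewrite ⊛-scaleˡ c (tail f) g n = solve 4 (λ c a b x →
    c :* a :* b :+ c :* x := c :* (a :* b :+ x)) refl c (f 0) (g (suc n)) ((tail f ⊛ g) n)
    where open +-*-Solver

  ⊛-assoc-pointwise : ∀ f g h n → ((f ⊛ g) ⊛ h) n ≡ (f ⊛ (g ⊛ h)) n
  ⊛-assoc-pointwise f g h zero = solve 3 (λ a b c →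
    (a :* b :+ con 0ℤ) :* c :+ con 0ℤ := a :* (b :* c :+ con 0ℤ) :+ con 0ℤ) refl (f 0) (g 0) (h 0)
    where open +-*-Solver
  ⊛-assoc-pointwise f g h (suc n) = begin
    (f 0 ℤ.* g 0 ℤ.+ 0ℤ) ℤ.* h (suc n) ℤ.+ (tail (f ⊛ g) ⊛ h) n
      ≡⟨ cong (λ z → (f 0 ℤ.* g 0 ℤ.+ 0ℤ) ℤ.* h (suc n) ℤ.+ z) (trans
           (⊛-distribʳ (λ i → f 0 ℤ.* g (suc i)) (tail f ⊛ g) h n)
           (cong₂ ℤ._+_ (⊛-scaleˡ (f 0) (tail g) h n) (⊛-assoc-pointwise (tail f) g h n))) ⟩
    (f 0 ℤ.* g 0 ℤ.+ 0ℤ) ℤ.* h (suc n) ℤ.+ (f 0 ℤ.* (tail g ⊛ h) n ℤ.+ (tail f ⊛ (g ⊛ h)) n)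
      ≡⟨ solve 5 (λ a b c x y → (a :* b :+ con 0ℤ) :* c :+ (a :* x :+ y) :=
           a :* (b :* c :+ x) :+ y) refl (f 0) (g 0) (h (suc n)) ((tail g ⊛ h) n) _ ⟩
    f 0 ℤ.* (g 0 ℤ.* h (suc n) ℤ.+ (tail g ⊛ h) n) ℤ.+ (tail f ⊛ (g ⊛ h)) n ∎
    where open ≡-Reasoning
          open +-*-Solver

  -- The Cauchy product unfolds by its first term; peeling off the last one instead is what lets
  -- commutativity go by induction.
  ⊛-suc : ∀ f g n → (f ⊛ g) (suc n) ≡ f (suc n) ℤ.* g 0 ℤ.+ (f ⊛ tail g) n
  ⊛-suc f g zero = solve 4 (λ a b c d →
    a :* d :+ (b :* c :+ con 0ℤ) := b :* c :+ (a :* d :+ con 0ℤ)) refl (f 0) (f 1) (g 0) (g 1)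
    where open +-*-Solver
  ⊛-suc f g (suc n) rewrite ⊛-suc (tail f) g n = solve 3 (λ x y z →
    x :+ (y :+ z) := y :+ (x :+ z)) refl (f 0 ℤ.* g (suc (suc n))) (f (suc (suc n)) ℤ.* g 0) _
    where open +-*-Solver

  ⊛-comm-pointwise : ∀ f g n → (f ⊛ g) n ≡ (g ⊛ f) n
  ⊛-comm-pointwise f g zero = cong (ℤ._+ 0ℤ) (ℤ.*-comm (f 0) (g 0))
  ⊛-comm-pointwise f g (suc n) = trans (⊛-suc f g n)
    (cong₂ ℤ._+_ (ℤ.*-comm (f (suc n)) (g 0)) (⊛-comm-pointwise f (tail g) n))

  ⊛-zeroˡ : ∀ f n → ((λ _ → 0ℤ) ⊛ f) n ≡ 0ℤ
  ⊛-zeroˡ f zero    = refl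
  ⊛-zeroˡ f (suc n) = trans (ℤ.+-identityˡ _) (⊛-zeroˡ f n)

  const-⊛ : ∀ c f n → (const c ⊛ f) n ≡ c ℤ.* f n
  const-⊛ c f zero    = ℤ.+-identityʳ _
  const-⊛ c f (suc n) = trans (cong (λ z → c ℤ.* f (suc n) ℤ.+ z) (⊛-zeroˡ f n)) (ℤ.+-identityʳ _)

  D1#≈1# : D.1# ≈ 1#
  D1#≈1# = agree λ { zero → refl ; (suc _) → refl }

  ⊛-identityˡ′ : ∀ f → 1# ⊛ f ≈ f
  ⊛-identityˡ′ f = agree λ n → trans (const-⊛ 1ℤ f n) (ℤ.*-identityˡ (f n))

  ⊕-isAbelianGroup : IsAbelianGroup _≈_ _⊕_ 0# ⊝_
  ⊕-isAbelianGroup = record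
    { isGroup = record
      { isMonoid = record
        { isSemigroup = record
          { isMagma = record
            { isEquivalence = ≈-isEquivalence
            ; ∙-cong = λ ff gg → agree λ n → cong₂ ℤ._+_ (coeff ff n) (coeff gg n)
            }
          ; assoc = λ f g h → agree λ n → ℤ.+-assoc (f n) (g n) (h n)
          }
        ; identity = (λ f → agree λ n → ℤ.+-identityˡ (f n))
                   , (λ f → agree λ n → ℤ.+-identityʳ (f n))
        }
      ; inverse = (λ f → agree λ n → ℤ.+-inverseˡ (f n))
                , (λ f → agree λ n → ℤ.+-inverseʳ (f n))
      ; ⁻¹-cong = λ ff → agree λ n → cong ℤ.-_ (coeff ff n)
      }
    ; comm = λ f g → agree λ n → ℤ.+-comm (f n) (g n)
    }

  ⊛-assoc′ : ∀ f g h → (f ⊛ g) ⊛ h ≈ f ⊛ (g ⊛ h)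
  ⊛-assoc′ f g h = agree (⊛-assoc-pointwise f g h)

  ⊛-comm′ : ∀ f g → f ⊛ g ≈ g ⊛ f
  ⊛-comm′ f g = agree (⊛-comm-pointwise f g)

  ⊛-distribʳ′ : ∀ f g h → (g ⊕ h) ⊛ f ≈ g ⊛ f ⊕ h ⊛ f
  ⊛-distribʳ′ f g h = agree (⊛-distribʳ g h f)

  const-⊕ : ∀ a b → const (a ℤ.+ b) ≈ const a ⊕ const b
  const-⊕ a b = agree λ { zero → refl ; (suc _) → refl }

  const-* : ∀ a b → const (a ℤ.* b) ≈ const a ⊛ const b
  const-* a b = agree λ { zero → sym (const-⊛ a (const b) 0)
                        ; (suc n) → sym (trans (const-⊛ a (const b) (suc n)) (ℤ.*-zeroʳ a)) }

  const-⊝ : ∀ a → const (ℤ.- a) ≈ ⊝ const a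
  const-⊝ a = agree λ { zero → refl ; (suc _) → refl }

  const-0 : const 0ℤ ≈ 0#
  const-0 = agree λ { zero → refl ; (suc _) → refl }

  0#-coeff : ∀ n → 0# n ≡ 0ℤ
  0#-coeff n = refl

  ⊕-coeff : ∀ f g n → (f ⊕ g) n ≡ f n ℤ.+ g n
  ⊕-coeff f g n = refl

  ⊝-coeff : ∀ f n → (⊝ f) n ≡ ℤ.- f n
  ⊝-coeff f n = refl

series : CommutativeRing 0ℓ 0ℓ
series = record
  { Carrier = Series ; _≈_ = _≈_ ; _+_ = _⊕_ ; _*_ = _⊛_ ; -_ = ⊝_ ; 0# = 0# ; 1# = 1#
  ; isCommutativeRing = record
    { isRing = record
      { +-isAbelianGroup = ⊕-isAbelianGroup
      ; *-cong     = ⊛-cong′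
      ; *-assoc    = ⊛-assoc′
      ; *-identity = ⊛-identityˡ′ , λ f → ≈-trans′ (⊛-comm′ f 1#) (⊛-identityˡ′ f)
      ; distrib    = (λ f g h → ≈-trans′ (⊛-comm′ f (g ⊕ h)) (≈-trans′ (⊛-distribʳ′ f g h)
                        (IsAbelianGroup.∙-cong ⊕-isAbelianGroup (⊛-comm′ g f) (⊛-comm′ h f))))
                   , ⊛-distribʳ′
      }
    ; *-comm = ⊛-comm′
    }
  }
  where
  ≈-trans′ = IsEquivalence.trans ≈-isEquivalence
  ⊛-cong′ : ∀ {f f′ g g′} → f ≈ f′ → g ≈ g′ → f ⊛ g ≈ f′ ⊛ g′
  ⊛-cong′ ff gg = ≈[]⇒≈ λ _ → ⊛-cong[] (≈⇒≈[] ff) (≈⇒≈[] gg)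

open CommutativeRing series public using ()
  renaming ( refl to ≈-refl; reflexive to ≈-reflexive; sym to ≈-sym; trans to ≈-trans
           ; +-cong to ⊕-cong; *-cong to ⊛-cong; -‿cong to ⊝-cong
           ; +-congˡ to ⊕-congˡ; +-congʳ to ⊕-congʳ; *-congˡ to ⊛-congˡ; *-congʳ to ⊛-congʳ
           ; *-comm to ⊛-comm; zeroʳ to ⊛-zeroʳ; *-identityˡ to ⊛-identityˡ; *-identityʳ to ⊛-identityʳ
           ; +-identityˡ to ⊕-identityˡ; +-identityʳ to ⊕-identityʳ; setoid to ≈-setoid )

module ≈-Reasoning = SetoidReasoning ≈-setoid
module ≈[]-Reasoning (N : ℕ) = SetoidReasoning (≈[]-setoid N)

-- Integers serve as the coefficients of the solver, so that numerals in the identities are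
-- evaluated and not treated as atoms.
const-morphism : CommutativeRing.rawRing ℤ.+-*-commutativeRing
                   -Raw-AlmostCommutative⟶ fromCommutativeRing series
const-morphism = record
  { ⟦_⟧    = const
  ; +-homo = const-⊕
  ; *-homo = const-*
  ; -‿homo = const-⊝
  ; 0-homo = const-0
  ; 1-homo = ≈-refl
  }

const-≟ : ∀ a b → Maybe (const a ≈ const b)
const-≟ a b with a ℤ.≟ b
... | yes refl = just (agree λ _ → refl)
... | no  _    = nothing

module SeriesSolver = Algebra.Solver.Ring (CommutativeRing.rawRing ℤ.+-*-commutativeRing)
  (fromCommutativeRing series) const-morphism const-≟
open SeriesSolver public using (solve; _:=_; con; _:+_; _:*_; _:-_; :-_; _:^_)

open import Algebra.Properties.Semiring.Exp (CommutativeRing.semiring series) public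
  using () renaming (_^_ to _^ˢ_; ^-homo-* to ^ˢ-+; ^-congˡ to ^ˢ-congˡ; ^-assocʳ to ^ˢ-*)

-- The operators f(q) ↦ f(q²), f(−q) and the even and odd parts

data Parity : ℕ → Set where
  even : ∀ k → Parity (2 * k)
  odd  : ∀ k → Parity (suc (2 * k))

parity : ∀ n → Parity n
parity zero = even 0
parity (suc n) with parity n
... | even k = odd k
... | odd k  = subst Parity (ℕ.*-suc 2 k) (even (suc k))

opaque
  unfolding _⊕_

  U O V σ : Series → Series
  U f n = f (2 * n)
  O f n = f (suc (2 * n))
  V f zero          = f 0
  V f (suc zero)    = 0ℤ
  V f (suc (suc n)) = V (tail f) n
  σ f zero          = f 0
  σ f (suc n)       = ℤ.- σ (tail f) n

  U-⊕ : ∀ f g → U (f ⊕ g) ≈ U f ⊕ U g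
  U-⊕ f g = agree λ _ → refl

  O-⊕ : ∀ f g → O (f ⊕ g) ≈ O f ⊕ O g
  O-⊕ f g = agree λ _ → refl

  U-⊝ : ∀ f → U (⊝ f) ≈ ⊝ U f
  U-⊝ f = agree λ _ → refl

  O-⊝ : ∀ f → O (⊝ f) ≈ ⊝ O f
  O-⊝ f = agree λ _ → refl

  U-coeff : ∀ f n → U f n ≡ f (2 * n)
  U-coeff f n = refl

  O-coeff : ∀ f n → O f n ≡ f (suc (2 * n))
  O-coeff f n = refl

  UO-extensional : ∀ {f g} → U f ≈ U g → O f ≈ O g → f ≈ g
  UO-extensional {f} {g} uu oo = agree λ n → at (parity n)
    where
    at : ∀ {n} → Parity n → f n ≡ g n
    at (even k) = coeff uu k
    at (odd k)  = coeff oo k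

  U-cong : ∀ {f g} → f ≈ g → U f ≈ U g
  U-cong ff = agree λ n → coeff ff (2 * n)

  O-cong : ∀ {f g} → f ≈ g → O f ≈ O g
  O-cong ff = agree λ n → coeff ff (suc (2 * n))

  U-cong[] : ∀ {N f g} → f ≈[ 2 * N ] g → U f ≈[ N ] U g
  U-cong[] ff = agree λ n n<N → coeff< ff (2 * n) (ℕ.*-monoʳ-< 2 n<N)

  V-even : ∀ f k → V f (2 * k) ≡ f k
  V-even f zero = refl
  V-even f (suc k) = trans (cong (V f) (ℕ.*-suc 2 k)) (V-even (tail f) k)

  V-odd : ∀ f k → V f (suc (2 * k)) ≡ 0ℤ
  V-odd f zero = refl
  V-odd f (suc k) = trans (cong (λ m → V f (suc m)) (ℕ.*-suc 2 k)) (V-odd (tail f) k)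

  V-cong[] : ∀ {N f g} → f ≈[ N ] g → V f ≈[ N ] V g
  V-cong[] {N} {f} {g} ff = agree λ n → at (parity n)
    where
    at : ∀ {n} → Parity n → n < N → V f n ≡ V g n
    at (even k) n<N = trans (V-even f k)
      (trans (coeff< ff k (ℕ.≤-<-trans (ℕ.m≤n*m k 2) n<N)) (sym (V-even g k)))
    at (odd k) _ = trans (V-odd f k) (sym (V-odd g k))

  U-V : ∀ f → U (V f) ≈ f
  U-V f = agree (V-even f)

  O-V : ∀ f → O (V f) ≈ 0#
  O-V f = agree (V-odd f)

  V-const : ∀ c → V (const c) ≈ const c
  V-const c = agree λ n → at (parity n)
    where
    at : ∀ {n} → Parity n → V (const c) n ≡ const c n
    at (even zero)    = refl
    at (even (suc k)) = V-even (const c) (suc k)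
    at (odd k)        = V-odd (const c) k

  U-const : ∀ c → U (const c) ≈ const c
  U-const c = agree λ { zero → refl ; (suc _) → refl }

  O-const : ∀ c → O (const c) ≈ 0#
  O-const c = agree λ _ → refl

  -- Linearity over the series in q²: an even factor leaves U with q² replaced by q. Each later
  -- computation of U first brings a denominator into this form.
  U-V⊛ : ∀ f g → U (V f ⊛ g) ≈ f ⊛ U g
  U-V⊛ f g = agree (at f)
    where
    at : ∀ f n → U (V f ⊛ g) n ≡ (f ⊛ U g) n
    at f zero = refl
    at f (suc n) = trans (cong (V f ⊛ g) (ℕ.*-suc 2 n))
      (cong₂ ℤ._+_ (cong (λ m → f 0 ℤ.* g m) (sym (ℕ.*-suc 2 n)))
        (trans (ℤ.+-identityˡ _) (at (tail f) n)))

  O-V⊛ : ∀ f g → O (V f ⊛ g) ≈ f ⊛ O g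
  O-V⊛ f g = agree (at f)
    where
    at : ∀ f n → O (V f ⊛ g) n ≡ (f ⊛ O g) n
    at f zero = refl
    at f (suc n) = trans (cong (λ m → (V f ⊛ g) (suc m)) (ℕ.*-suc 2 n))
      (cong₂ ℤ._+_ (cong (λ m → f 0 ℤ.* g (suc m)) (sym (ℕ.*-suc 2 n)))
        (trans (ℤ.+-identityˡ _) (at (tail f) n)))

  tail-q : tail q ≈ 1#
  tail-q = agree λ { zero → refl ; (suc _) → refl }

tail-q⊛ : ∀ f → tail q ⊛ f ≈ f
tail-q⊛ f = ≈-trans (⊛-congʳ tail-q) (⊛-identityˡ f)

opaque
  unfolding _⊕_ U

  q⊛-suc : ∀ f n → (q ⊛ f) (suc n) ≡ f n
  q⊛-suc f n = trans (ℤ.+-identityˡ _) (coeff (tail-q⊛ f) n)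

  U-q⊛ : ∀ f → U (q ⊛ f) ≈ q ⊛ O f
  U-q⊛ f = agree λ { zero → refl
    ; (suc n) → trans (cong (q ⊛ f) (ℕ.*-suc 2 n)) (trans (q⊛-suc f _) (sym (q⊛-suc (O f) n))) }

  O-q⊛ : ∀ f → O (q ⊛ f) ≈ U f
  O-q⊛ f = agree λ n → q⊛-suc f (2 * n)

  σ-cong[] : ∀ {N f g} → f ≈[ N ] g → σ f ≈[ N ] σ g
  σ-cong[] ff = agree λ n n<N → at n (λ i i≤n → coeff< ff i (ℕ.≤-<-trans i≤n n<N))
    where
    at : ∀ n {f g} → (∀ i → i ≤ n → f i ≡ g i) → σ f n ≡ σ g n
    at zero    ff = ff 0 z≤n
    at (suc n) ff = cong ℤ.-_ (at n (λ i i≤n → ff (suc i) (s≤s i≤n)))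

  U-σ : ∀ f → U (σ f) ≈ U f
  U-σ f = agree (at f)
    where
    at : ∀ f n → U (σ f) n ≡ U f n
    at f zero = refl
    at f (suc n) = trans (cong (σ f) (ℕ.*-suc 2 n)) (trans (ℤ.neg-involutive _)
      (trans (at (tail (tail f)) n) (cong f (sym (ℕ.*-suc 2 n)))))

  O-σ : ∀ f → O (σ f) ≈ ⊝ O f
  O-σ f = agree λ n → cong ℤ.-_ (coeff (U-σ (tail f)) n)

V-cong : ∀ {f g} → f ≈ g → V f ≈ V g
V-cong ff = ≈[]⇒≈ λ _ → V-cong[] (≈⇒≈[] ff)

opaque
  unfolding _⊕_ U

  V-⊕ : ∀ f g → V (f ⊕ g) ≈ V f ⊕ V g
  V-⊕ f g = UO-extensional
    (≈-trans (U-V (f ⊕ g)) (≈-sym (⊕-cong (U-V f) (U-V g))))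
    (≈-trans (O-V (f ⊕ g)) (≈-sym (≈-trans (⊕-cong (O-V f) (O-V g)) (⊕-identityˡ 0#))))

  V-⊝ : ∀ f → V (⊝ f) ≈ ⊝ V f
  V-⊝ f = UO-extensional
    (≈-trans (U-V (⊝ f)) (≈-sym (⊝-cong (U-V f))))
    (≈-trans (O-V (⊝ f)) (≈-sym (⊝-cong (O-V f))))

V-⊛ : ∀ f g → V (f ⊛ g) ≈ V f ⊛ V g
V-⊛ f g = UO-extensional
  (≈-trans (U-V (f ⊛ g)) (≈-sym (≈-trans (U-V⊛ f (V g)) (⊛-congˡ (U-V g)))))
  (≈-trans (O-V (f ⊛ g)) (≈-sym (≈-trans (O-V⊛ f (V g)) (≈-trans (⊛-congˡ (O-V g)) (⊛-zeroʳ f)))))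

UO-split : ∀ f → f ≈ V (U f) ⊕ q ⊛ V (O f)
UO-split f = UO-extensional
  (≈-sym (≈-trans (U-⊕ _ _) (≈-trans (⊕-cong (U-V (U f))
    (≈-trans (U-q⊛ _) (≈-trans (⊛-congˡ (O-V (O f))) (⊛-zeroʳ q)))) (⊕-identityʳ (U f)))))
  (≈-sym (≈-trans (O-⊕ _ _) (≈-trans (⊕-cong (O-V (U f)) (≈-trans (O-q⊛ _) (U-V (O f))))
    (⊕-identityˡ (O f)))))

-- The module structure of ℤ[[q]] over V ℤ[[q]], with basis 1, q.
split-⊛ : ∀ f g → f ⊛ g ≈ V (U f) ⊛ g ⊕ V (O f) ⊛ (q ⊛ g)
split-⊛ f g = ≈-trans (⊛-congʳ (UO-split f))
  (solve 4 (λ a b q g → (a :+ q :* b) :* g := a :* g :+ b :* (q :* g)) ≈-refl (V (U f)) (V (O f)) q g)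

U-⊛ : ∀ f g → U (f ⊛ g) ≈ U f ⊛ U g ⊕ q ⊛ (O f ⊛ O g)
U-⊛ f g = begin
  U (f ⊛ g)                                  ≈⟨ ≈-trans (U-cong (split-⊛ f g)) (U-⊕ _ _) ⟩
  U (V (U f) ⊛ g) ⊕ U (V (O f) ⊛ (q ⊛ g))    ≈⟨ ⊕-cong (U-V⊛ (U f) g) (≈-trans (U-V⊛ (O f) (q ⊛ g)) (⊛-congˡ (U-q⊛ g))) ⟩
  U f ⊛ U g ⊕ O f ⊛ (q ⊛ O g)                ≈⟨ solve 4 (λ a b q c → a :+ b :* (q :* c) := a :+ q :* (b :* c)) ≈-refl (U f ⊛ U g) (O f) q (O g) ⟩
  U f ⊛ U g ⊕ q ⊛ (O f ⊛ O g)                ∎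
  where open ≈-Reasoning

O-⊛ : ∀ f g → O (f ⊛ g) ≈ U f ⊛ O g ⊕ O f ⊛ U g
O-⊛ f g = begin
  O (f ⊛ g)                                  ≈⟨ ≈-trans (O-cong (split-⊛ f g)) (O-⊕ _ _) ⟩
  O (V (U f) ⊛ g) ⊕ O (V (O f) ⊛ (q ⊛ g))    ≈⟨ ⊕-cong (O-V⊛ (U f) g) (≈-trans (O-V⊛ (O f) (q ⊛ g)) (⊛-congˡ (O-q⊛ g))) ⟩
  U f ⊛ O g ⊕ O f ⊛ U g                      ∎
  where open ≈-Reasoning

U-const⊛ : ∀ c f → U (const c ⊛ f) ≈ const c ⊛ U f
U-const⊛ c f = ≈-trans (U-cong (⊛-congʳ (≈-sym (V-const c)))) (U-V⊛ (const c) f)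

O-const⊛ : ∀ c f → O (const c ⊛ f) ≈ const c ⊛ O f
O-const⊛ c f = ≈-trans (O-cong (⊛-congʳ (≈-sym (V-const c)))) (O-V⊛ (const c) f)

σ-cong : ∀ {f g} → f ≈ g → σ f ≈ σ g
σ-cong ff = ≈[]⇒≈ λ _ → σ-cong[] (≈⇒≈[] ff)

opaque
  unfolding _⊕_ U

  σ-⊕ : ∀ f g → σ (f ⊕ g) ≈ σ f ⊕ σ g
  σ-⊕ f g = UO-extensional (≈-trans (U-σ (f ⊕ g)) (≈-sym (⊕-cong (U-σ f) (U-σ g))))
    (≈-trans (O-σ (f ⊕ g)) (≈-trans
      (solve 2 (λ a b → :- (a :+ b) := :- a :+ :- b) ≈-refl (O f) (O g))
      (≈-sym (⊕-cong (O-σ f) (O-σ g)))))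

  σ-⊝ : ∀ f → σ (⊝ f) ≈ ⊝ σ f
  σ-⊝ f = UO-extensional (≈-trans (U-σ (⊝ f)) (≈-sym (⊝-cong (U-σ f))))
    (≈-trans (O-σ (⊝ f)) (≈-sym (⊝-cong (O-σ f))))

σ-⊛ : ∀ f g → σ (f ⊛ g) ≈ σ f ⊛ σ g
σ-⊛ f g = UO-extensional
  (begin
    U (σ (f ⊛ g))                       ≈⟨ ≈-trans (U-σ (f ⊛ g)) (U-⊛ f g) ⟩
    U f ⊛ U g ⊕ q ⊛ (O f ⊛ O g)         ≈⟨ solve 4 (λ x q a b → x :+ q :* (a :* b) := x :+ q :* (:- a :* :- b)) ≈-refl (U f ⊛ U g) q (O f) (O g) ⟩
    U f ⊛ U g ⊕ q ⊛ ((⊝ O f) ⊛ (⊝ O g)) ≈⟨ ⊕-cong (⊛-cong (U-σ f) (U-σ g)) (⊛-congˡ (⊛-cong (O-σ f) (O-σ g))) ⟨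
    U (σ f) ⊛ U (σ g) ⊕ q ⊛ (O (σ f) ⊛ O (σ g)) ≈⟨ U-⊛ (σ f) (σ g) ⟨
    U (σ f ⊛ σ g)                       ∎)
  (begin
    O (σ (f ⊛ g))                       ≈⟨ ≈-trans (O-σ (f ⊛ g)) (⊝-cong (O-⊛ f g)) ⟩
    ⊝ (U f ⊛ O g ⊕ O f ⊛ U g)           ≈⟨ solve 4 (λ a b c d → :- (a :* d :+ c :* b) := a :* :- d :+ :- c :* b) ≈-refl (U f) (U g) (O f) (O g) ⟩
    U f ⊛ (⊝ O g) ⊕ (⊝ O f) ⊛ U g       ≈⟨ ⊕-cong (⊛-cong (U-σ f) (O-σ g)) (⊛-cong (O-σ f) (U-σ g)) ⟨
    U (σ f) ⊛ O (σ g) ⊕ O (σ f) ⊛ U (σ g) ≈⟨ O-⊛ (σ f) (σ g) ⟨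
    O (σ f ⊛ σ g)                       ∎)
  where open ≈-Reasoning

opaque
  unfolding _⊕_ U

  σ-V : ∀ f → σ (V f) ≈ V f
  σ-V f = UO-extensional (U-σ (V f))
    (≈-trans (O-σ (V f)) (≈-trans (⊝-cong (O-V f)) (≈-trans (agree λ _ → refl) (≈-sym (O-V f)))))

σ-const : ∀ c → σ (const c) ≈ const c
σ-const c = ≈-trans (σ-cong (≈-sym (V-const c))) (≈-trans (σ-V (const c)) (V-const c))

opaque
  unfolding σ

  σ-q : σ q ≈ ⊝ q
  σ-q = agree λ { zero → refl ; (suc n) → cong ℤ.-_
    (trans (coeff (σ-cong tail-q) n) (trans (coeff (σ-const 1ℤ) n) (sym (coeff tail-q n)))) }

U-q : U q ≈ 0#
U-q = ≈-trans (U-cong (≈-sym (⊛-identityʳ q)))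
  (≈-trans (U-q⊛ 1#) (≈-trans (⊛-congˡ (O-const 1ℤ)) (⊛-zeroʳ q)))

O-q : O q ≈ 1#
O-q = ≈-trans (O-cong (≈-sym (⊛-identityʳ q))) (≈-trans (O-q⊛ 1#) (U-const 1ℤ))

V-q : V q ≈ q ⊛ q
V-q = UO-extensional
  (≈-trans (U-V q) (≈-sym (≈-trans (U-q⊛ q) (≈-trans (⊛-congˡ O-q) (⊛-identityʳ q)))))
  (≈-trans (O-V q) (≈-sym (≈-trans (O-q⊛ q) U-q)))

-- Linear combinations of equations, and inverses

⊖-cancel : ∀ {f g} → f ≈ g → f ⊖ g ≈ 0#
⊖-cancel {f} {g} f≈g = ≈-trans (⊕-congʳ f≈g) (CommutativeRing.-‿inverseʳ series g)

⊖-zero : ∀ {f g} → f ⊖ g ≈ 0# → f ≈ g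
⊖-zero {f} {g} f-g≈0 = begin
  f            ≈⟨ solve 2 (λ f g → f := (f :- g) :+ g) ≈-refl f g ⟩
  (f ⊖ g) ⊕ g  ≈⟨ ⊕-congʳ f-g≈0 ⟩
  0# ⊕ g       ≈⟨ ⊕-identityˡ g ⟩
  g            ∎
  where open ≈-Reasoning

⊖-cancel[] : ∀ {N f g} → f ≈[ N ] g → f ⊖ g ≈[ N ] 0#
⊖-cancel[] {N} {f} {g} f≈g = ≈[]-trans (⊕-cong[] f≈g ≈[]-refl) (≈⇒≈[] (⊖-cancel ≈-refl))

⊖-zero[] : ∀ {N f g} → f ⊖ g ≈[ N ] 0# → f ≈[ N ] g
⊖-zero[] {N} {f} {g} f-g≈0 = begin
  f            ≈⟨ ≈⇒≈[] (solve 2 (λ f g → f := (f :- g) :+ g) ≈-refl f g) ⟩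
  (f ⊖ g) ⊕ g  ≈⟨ ⊕-cong[] f-g≈0 ≈[]-refl ⟩
  0# ⊕ g       ≈⟨ ≈⇒≈[] (⊕-identityˡ g) ⟩
  g            ∎
  where open ≈[]-Reasoning N

infixr 7 _∙_ _∙[]_
infixr 6 _⊞_ _⊞[]_

_∙_ : ∀ c {f g} → f ≈ g → c ⊛ (f ⊖ g) ≈ 0#
c ∙ f≈g = ≈-trans (⊛-congˡ (⊖-cancel f≈g)) (⊛-zeroʳ c)

_⊞_ : ∀ {f g} → f ≈ 0# → g ≈ 0# → f ⊕ g ≈ 0#
f≈0 ⊞ g≈0 = ≈-trans (⊕-cong f≈0 g≈0) (⊕-identityˡ 0#)

_∙[]_ : ∀ {N} c {f g} → f ≈[ N ] g → c ⊛ (f ⊖ g) ≈[ N ] 0#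
c ∙[] f≈g = ≈[]-trans (⊛-cong[] ≈[]-refl (⊖-cancel[] f≈g)) (≈⇒≈[] (⊛-zeroʳ c))

_⊞[]_ : ∀ {N f g} → f ≈[ N ] 0# → g ≈[ N ] 0# → f ⊕ g ≈[ N ] 0#
f≈0 ⊞[] g≈0 = ≈[]-trans (⊕-cong[] f≈0 g≈0) (≈⇒≈[] (⊕-identityˡ 0#))

-- Proof by certificate: L - R is written as a combination of the differences of known equations,
-- with the cofactors standing before `∙`, and the ring solver checks the resulting polynomial
-- identity.
combine : ∀ {L R Z} → Z ≈ 0# → L ⊖ R ≈ Z → L ≈ R
combine Z≈0 L-R≈Z = ⊖-zero (≈-trans L-R≈Z Z≈0)

combine[] : ∀ {N L R Z} → Z ≈[ N ] 0# → L ⊖ R ≈ Z → L ≈[ N ] R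
combine[] Z≈0 L-R≈Z = ⊖-zero[] (≈[]-trans (≈⇒≈[] L-R≈Z) Z≈0)

opaque
  unfolding _⊕_

  ⊛-coeff0 : ∀ f g → (f ⊛ g) 0 ≡ f 0 ℤ.* g 0
  ⊛-coeff0 f g = ℤ.+-identityʳ _

  ⊖-coeff0 : ∀ f g → (f ⊖ g) 0 ≡ f 0 ℤ.- g 0
  ⊖-coeff0 f g = refl

  ⊝-coeff0 : ∀ f → (⊝ f) 0 ≡ ℤ.- f 0
  ⊝-coeff0 f = refl

  const-coeff0 : ∀ c → const c 0 ≡ c
  const-coeff0 c = refl

  ⁻¹-inverse : ∀ f → f 0 ≡ 1ℤ → f ⊛ f D.⁻¹ ≈ 1#
  ⁻¹-inverse f f₀≡1 = agree λ
    { zero → D.⁻¹-inverse f f₀≡1 0 ; (suc n) → D.⁻¹-inverse f f₀≡1 (suc n) }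

  ⊛-order : ∀ {k m f g} → f ≈[ k ] 0# → g ≈[ m ] 0# → f ⊛ g ≈[ k + m ] 0#
  ⊛-order {f = f} {g} f≈0 g≈0 = agree (D.⊛-order f g (coeff< f≈0) (coeff< g≈0))

⊛-orderʳ : ∀ {N} f {g} → g ≈[ N ] 0# → f ⊛ g ≈[ N ] 0#
⊛-orderʳ f g≈0 = ≈[]-trans (⊛-cong[] ≈[]-refl g≈0) (≈⇒≈[] (⊛-zeroʳ f))

⊛-orderˡ : ∀ {N f} g → f ≈[ N ] 0# → f ⊛ g ≈[ N ] 0#
⊛-orderˡ {f = f} g f≈0 = ≈[]-trans (≈⇒≈[] (⊛-comm f g)) (⊛-orderʳ g f≈0)

^ˢ-order : ∀ {f} → f 0 ≡ 0ℤ → ∀ m → f ^ˢ m ≈[ m ] 0#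
^ˢ-order f₀≡0 zero    = agree λ _ ()
^ˢ-order {f} f₀≡0 (suc m) = ⊛-order {1} (agree λ { zero _ → trans f₀≡0 (sym (0#-coeff 0)) ; (suc _) (s≤s ()) })
  (^ˢ-order f₀≡0 m)

1⊖-coeff0 : ∀ f g → f 0 ≡ 0ℤ → (1# ⊖ f ⊛ g) 0 ≡ 1ℤ
1⊖-coeff0 f g f₀≡0 = trans (⊖-coeff0 1# (f ⊛ g)) (cong₂ ℤ._-_ (const-coeff0 1ℤ)
  (trans (⊛-coeff0 f g) (cong (ℤ._* g 0) f₀≡0)))

module _ {N : ℕ} {u : Series} (u₀≡1 : u 0 ≡ 1ℤ) where
  ⊛-cancelˡ[] : ∀ {f g} → u ⊛ f ≈[ N ] u ⊛ g → f ≈[ N ] g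
  ⊛-cancelˡ[] {f} {g} uf≈ug = combine[]
    (u D.⁻¹ ∙[] uf≈ug ⊞[] (⊝ (f ⊖ g)) ∙[] ≈⇒≈[] (⁻¹-inverse u u₀≡1))
    (solve 4 (λ u i f g → f :- g := i :* (u :* f :- u :* g) :+ :- (f :- g) :* (u :* i :- con 1ℤ)) ≈-refl u (u D.⁻¹) f g)

⁻¹-cong[] : ∀ {N u v} → u 0 ≡ 1ℤ → v 0 ≡ 1ℤ → u ≈[ N ] v → u D.⁻¹ ≈[ N ] v D.⁻¹
⁻¹-cong[] {N} {u} {v} u₀≡1 v₀≡1 u≈v = combine[]
  ((⊝ (u D.⁻¹ ⊛ v D.⁻¹)) ∙[] u≈v ⊞[] v D.⁻¹ ∙[] ≈⇒≈[] (⁻¹-inverse u u₀≡1)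
    ⊞[] (⊝ u D.⁻¹) ∙[] ≈⇒≈[] (⁻¹-inverse v v₀≡1))
  (solve 4 (λ u v i j → i :- j := :- (i :* j) :* (u :- v) :+ (j :* (u :* i :- con 1ℤ) :+ (:- i) :* (v :* j :- con 1ℤ)))
    ≈-refl u v (u D.⁻¹) (v D.⁻¹))

⁻¹-cong : ∀ {u v} → u 0 ≡ 1ℤ → v 0 ≡ 1ℤ → u ≈ v → u D.⁻¹ ≈ v D.⁻¹
⁻¹-cong u₀≡1 v₀≡1 u≈v = ≈[]⇒≈ λ _ → ⁻¹-cong[] u₀≡1 v₀≡1 (≈⇒≈[] u≈v)

-- A telescoping well-poised bilateral sum

∑< : (ℕ → Series) → ℕ → Series
∑< f zero    = 0#
∑< f (suc n) = ∑< f n ⊕ f n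

∑<-cong[] : ∀ {N f g} → (∀ m → f m ≈[ N ] g m) → ∀ M → ∑< f M ≈[ N ] ∑< g M
∑<-cong[] ff zero    = ≈[]-refl
∑<-cong[] ff (suc M) = ⊕-cong[] (∑<-cong[] ff M) (ff M)

denom⁻¹ : Series → Series → ℕ → Series
denom⁻¹ b z m = (1# ⊖ z ⊛ b ^ˢ m) D.⁻¹

-- The terms of Σ_m b^{m(m−1)/2} ∏_{i<m} (z − a b^{i+1}) / (1 − z bⁱ), and
-- their companions with numerators z − a bⁱ, which certify the telescoping.
-- denom⁻¹ is junk unless z has no constant term.
term cert : Series → Series → Series → ℕ → Series
term a b z zero    = 1#
term a b z (suc m) = term a b z m ⊛ (b ^ˢ m ⊛ ((z ⊖ a ⊛ b ^ˢ suc m) ⊛ denom⁻¹ b z m))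
cert a b z zero    = 1#
cert a b z (suc m) = cert a b z m ⊛ (b ^ˢ m ⊛ ((z ⊖ a ⊛ b ^ˢ m) ⊛ denom⁻¹ b z m))

module _ (a b z : Series) (z₀≡0 : z 0 ≡ 0ℤ) where

  denom-inverse : ∀ m → (1# ⊖ z ⊛ b ^ˢ m) ⊛ denom⁻¹ b z m ≈ 1#
  denom-inverse m = ⁻¹-inverse _ (1⊖-coeff0 z (b ^ˢ m) z₀≡0)

  -- The numerators ∏ (z - a b^{i+1}) and ∏ (z - a bⁱ) differ only in their end factors, here
  -- cross-multiplied.
  term-cert : ∀ m → term a b z m ⊛ (z ⊖ a) ≈ cert a b z m ⊛ (z ⊖ a ⊛ b ^ˢ m)
  term-cert zero = solve 2 (λ z a → con 1ℤ :* (z :- a) := con 1ℤ :* (z :- a :* con 1ℤ)) ≈-refl z a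
  term-cert (suc m) = combine
    ((b ^ˢ m ⊛ ((z ⊖ a ⊛ b ^ˢ suc m) ⊛ denom⁻¹ b z m)) ∙ term-cert m)
    (solve 7 (λ w e x b z a i →
      w :* (x :* ((z :- a :* (b :* x)) :* i)) :* (z :- a) :- e :* (x :* ((z :- a :* x) :* i)) :* (z :- a :* (b :* x))
      := (x :* ((z :- a :* (b :* x)) :* i)) :* (w :* (z :- a) :- e :* (z :- a :* x)))
     ≈-refl (term a b z m) (cert a b z m) (b ^ˢ m) b z a (denom⁻¹ b z m))

  zb₀≡0 : (z ⊛ b) 0 ≡ 0ℤ
  zb₀≡0 = trans (⊛-coeff0 z b) (cong (ℤ._* b 0) z₀≡0)

  denom⁻¹-shift : ∀ m → denom⁻¹ b (z ⊛ b) m ≈ denom⁻¹ b z (suc m)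
  denom⁻¹-shift m = ⁻¹-cong (1⊖-coeff0 _ _ zb₀≡0) (1⊖-coeff0 z _ z₀≡0)
    (solve 3 (λ z b x → con 1ℤ :- z :* b :* x := con 1ℤ :- z :* (b :* x)) ≈-refl z b (b ^ˢ m))

  -- Replacing z by z b releases a factor b from each numerator and shifts the denominators by one
  -- place, so that only 1 - z and 1 - z b^m survive. Both sums are thereby expressed through the
  -- same `cert`.
  term-shift : ∀ m → term a b (z ⊛ b) m ⊛ (1# ⊖ z ⊛ b ^ˢ m) ≈ cert a b z m ⊛ (b ^ˢ m ⊛ (1# ⊖ z))
  term-shift zero = solve 1 (λ z → con 1ℤ :* (con 1ℤ :- z :* con 1ℤ) := con 1ℤ :* (con 1ℤ :* (con 1ℤ :- z))) ≈-refl z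
  term-shift (suc m) = combine
    ( (term a b (z ⊛ b) m ⊛ (b ^ˢ m ⊛ ((z ⊛ b ⊖ a ⊛ b ^ˢ suc m) ⊛ (1# ⊖ z ⊛ b ^ˢ suc m)))) ∙ denom⁻¹-shift m
    ⊞ (term a b (z ⊛ b) m ⊛ (b ^ˢ m ⊛ (z ⊛ b ⊖ a ⊛ b ^ˢ suc m))) ∙ denom-inverse (suc m)
    ⊞ (⊝ (term a b (z ⊛ b) m ⊛ (b ^ˢ m ⊛ (z ⊛ b ⊖ a ⊛ b ^ˢ suc m)))) ∙ denom-inverse m
    ⊞ (b ^ˢ m ⊛ ((z ⊛ b ⊖ a ⊛ b ^ˢ suc m) ⊛ denom⁻¹ b z m)) ∙ term-shift m )
    (solve 9 (λ w e x b z a i j k →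
      w :* (x :* ((z :* b :- a :* (b :* x)) :* k)) :* (con 1ℤ :- z :* (b :* x))
        :- e :* (x :* ((z :- a :* x) :* i)) :* ((b :* x) :* (con 1ℤ :- z))
      := (w :* (x :* ((z :* b :- a :* (b :* x)) :* (con 1ℤ :- z :* (b :* x))))) :* (k :- j)
      :+ ((w :* (x :* (z :* b :- a :* (b :* x)))) :* ((con 1ℤ :- z :* (b :* x)) :* j :- con 1ℤ)
      :+ (:- (w :* (x :* (z :* b :- a :* (b :* x)))) :* ((con 1ℤ :- z :* x) :* i :- con 1ℤ)
      :+ (x :* ((z :* b :- a :* (b :* x)) :* i)) :* (w :* (con 1ℤ :- z :* x) :- e :* (x :* (con 1ℤ :- z))))))
     ≈-refl (term a b (z ⊛ b) m) (cert a b z m) (b ^ˢ m) b z a (denom⁻¹ b z m) (denom⁻¹ b z (suc m)) (denom⁻¹ b (z ⊛ b) m))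

  module _ (a²≈1 : a ⊛ a ≈ 1#) where

    -- As a² = 1, the factor 1 - a z is -a (z - a), so `term-cert` applies to the first term and
    -- `term-shift` to the second. What remains is a rational identity in z and b^m.
    term-telescopes : ∀ m →
      (1# ⊖ z) ⊛ (1# ⊖ a ⊛ z) ⊛ term a b z m ⊖ (1# ⊖ a ⊛ (z ⊛ z)) ⊛ term a b (z ⊛ b) m
        ≈ a ⊛ z ⊛ (1# ⊖ z) ⊛ (cert a b z (suc m) ⊖ cert a b z m)
    term-telescopes m = combine
      ( ((1# ⊖ z) ⊛ (e ⊛ (x ⊛ i) ⊖ w)) ∙ a²≈1
      ⊞ (⊝ (a ⊛ (1# ⊖ z))) ∙ term-cert m
      ⊞ (⊝ ((1# ⊖ a ⊛ (z ⊛ z)) ⊛ i)) ∙ term-shift m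
      ⊞ ((1# ⊖ a ⊛ (z ⊛ z)) ⊛ w′ ⊖ (1# ⊖ z) ⊛ (e ⊛ (a ⊛ (a ⊛ x)))) ∙ denom-inverse m )
      (solve 7 (λ w w′ e x z a i →
        ((con 1ℤ :- z) :* (con 1ℤ :- a :* z) :* w :- (con 1ℤ :- a :* (z :* z)) :* w′)
          :- a :* z :* (con 1ℤ :- z) :* (e :* (x :* ((z :- a :* x) :* i)) :- e)
        := ((con 1ℤ :- z) :* (e :* (x :* i) :- w)) :* (a :* a :- con 1ℤ)
        :+ (:- (a :* (con 1ℤ :- z)) :* (w :* (z :- a) :- e :* (z :- a :* x))
        :+ (:- ((con 1ℤ :- a :* (z :* z)) :* i) :* (w′ :* (con 1ℤ :- z :* x) :- e :* (x :* (con 1ℤ :- z)))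
        :+ ((con 1ℤ :- a :* (z :* z)) :* w′ :- (con 1ℤ :- z) :* (e :* (a :* (a :* x)))) :* ((con 1ℤ :- z :* x) :* i :- con 1ℤ))))
       ≈-refl w w′ e x z a i)
      where
      w = term a b z m
      w′ = term a b (z ⊛ b) m
      e = cert a b z m
      x = b ^ˢ m
      i = denom⁻¹ b z m

    ∑-telescopes : ∀ M →
      (1# ⊖ z) ⊛ (1# ⊖ a ⊛ z) ⊛ ∑< (term a b z) M ⊖ (1# ⊖ a ⊛ (z ⊛ z)) ⊛ ∑< (term a b (z ⊛ b)) M
        ≈ a ⊛ z ⊛ (1# ⊖ z) ⊛ (cert a b z M ⊖ 1#)
    ∑-telescopes zero = ≈-trans
      (⊕-cong (⊛-zeroʳ _) (⊝-cong (⊛-zeroʳ _)))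
      (≈-trans (⊖-cancel ≈-refl) (≈-sym (≈-trans (⊛-congˡ (⊖-cancel ≈-refl)) (⊛-zeroʳ _))))
    ∑-telescopes (suc M) = combine
      (1# ∙ ∑-telescopes M ⊞ 1# ∙ term-telescopes M)
      (solve 9 (λ k l s t w w′ r c c′ →
        (k :* (s :+ w) :- l :* (t :+ w′)) :- r :* (c′ :- con 1ℤ)
        := con 1ℤ :* ((k :* s :- l :* t) :- r :* (c :- con 1ℤ)) :+ con 1ℤ :* ((k :* w :- l :* w′) :- r :* (c′ :- c)))
       ≈-refl ((1# ⊖ z) ⊛ (1# ⊖ a ⊛ z)) (1# ⊖ a ⊛ (z ⊛ z)) (∑< (term a b z) M) (∑< (term a b (z ⊛ b)) M)
         (term a b z M) (term a b (z ⊛ b) M) (a ⊛ z ⊛ (1# ⊖ z)) (cert a b z M) (cert a b z (suc M)))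

≈[]-0 : ∀ {N f} → f ≈[ N ] 0# → f ≈[ N ] const 0ℤ
≈[]-0 f≈0 = ≈[]-trans f≈0 (≈⇒≈[] (≈-sym const-0))

-- The value of `term` at z = 0, that is (-a)^m b^{m²}: the theta series arise from here.
limit : Series → Series → ℕ → Series
limit a b zero    = 1#
limit a b (suc m) = limit a b m ⊛ (b ^ˢ m ⊛ ⊝ (a ⊛ b ^ˢ suc m))

module _ (a b z : Series) (z₀≡0 : z 0 ≡ 0ℤ) where

  term-limit : ∀ {N} → z ≈[ N ] 0# → ∀ m → term a b z m ≈[ N ] limit a b m
  term-limit z≈0 zero    = ≈[]-refl
  term-limit z≈0 (suc m) = combine[]
    ( (x ⊛ ((z ⊖ a ⊛ (b ⊛ x)) ⊛ i)) ∙[] term-limit z≈0 m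
    ⊞[] (l ⊛ (x ⊛ i) ⊖ l ⊛ (x ⊛ (a ⊛ (b ⊛ (x ⊛ (x ⊛ i)))))) ∙[] ≈[]-0 z≈0
    ⊞[] (⊝ (l ⊛ (x ⊛ (a ⊛ (b ⊛ x))))) ∙[] ≈⇒≈[] (denom-inverse a b z z₀≡0 m) )
    (solve 7 (λ w l x a b z i →
      w :* (x :* ((z :- a :* (b :* x)) :* i)) :- l :* (x :* :- (a :* (b :* x)))
      := (x :* ((z :- a :* (b :* x)) :* i)) :* (w :- l)
      :+ ((l :* (x :* i) :- l :* (x :* (a :* (b :* (x :* (x :* i)))))) :* (z :- con 0ℤ)
      :+ (:- (l :* (x :* (a :* (b :* x))))) :* ((con 1ℤ :- z :* x) :* i :- con 1ℤ)))
     ≈-refl (term a b z m) l x a b z i)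
    where
    l = limit a b m
    x = b ^ˢ m
    i = denom⁻¹ b z m

  -- The factor b^m of the last step already has order m, so the upper boundary of a telescoped sum
  -- of N + 1 terms vanishes modulo q^N.
  cert-order : b 0 ≡ 0ℤ → ∀ m → cert a b z (suc m) ≈[ m ] const 0ℤ
  cert-order b₀≡0 m = ≈[]-0 (⊛-orderʳ _ (⊛-orderˡ _ (^ˢ-order b₀≡0 m)))

-- Twice a sum over m ≥ 0 minus its first term: the bilateral sum
-- (for E, its even part in q with q² replaced by q).
T E : ℕ → Series → Series
T M z = const (+ 2) ⊛ ∑< (term 1# q z) M ⊖ 1#
E M z = const (+ 2) ⊛ U (∑< (term (const -1ℤ) (V q) z) M) ⊖ 1#

q₀≡0 : q 0 ≡ 0ℤ
q₀≡0 = refl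

V-coeff0 : ∀ f → V f 0 ≡ f 0
V-coeff0 f = trans (sym (U-coeff (V f) 0)) (coeff (U-V f) 0)

1⊖₀≡1 : ∀ {f} → f 0 ≡ 0ℤ → (1# ⊖ f) 0 ≡ 1ℤ
1⊖₀≡1 {f} f₀≡0 = trans (⊖-coeff0 1# f) (cong₂ ℤ._-_ (const-coeff0 1ℤ) f₀≡0)

-- For a = 1 a common factor 1 - z cancels, and the lower boundary leaves -z on the right. Passing
-- from a sum s to 2s - 1 absorbs it and makes the recurrence homogeneous.
T-recurrence : ∀ N {z} → z 0 ≡ 0ℤ → (1# ⊖ z) ⊛ T (suc N) z ≈[ N ] (1# ⊕ z) ⊛ T (suc N) (z ⊛ q)
T-recurrence N {z} z₀≡0 = ⊛-cancelˡ[] (1⊖₀≡1 z₀≡0) (combine[]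
  ( const (+ 2) ∙[] ≈⇒≈[] (∑-telescopes 1# q z z₀≡0 (⊛-identityˡ 1#) (suc N))
  ⊞[] (const (+ 2) ⊛ (z ⊛ (1# ⊖ z))) ∙[] cert-order 1# q z z₀≡0 q₀≡0 N )
  (solve 4 (λ z s t c →
    (con 1ℤ :- z) :* ((con 1ℤ :- z) :* (con (+ 2) :* s :- con 1ℤ))
      :- (con 1ℤ :- z) :* ((con 1ℤ :+ z) :* (con (+ 2) :* t :- con 1ℤ))
    := con (+ 2) :* (((con 1ℤ :- z) :* (con 1ℤ :- con 1ℤ :* z) :* s :- (con 1ℤ :- con 1ℤ :* (z :* z)) :* t)
         :- con 1ℤ :* z :* (con 1ℤ :- z) :* (c :- con 1ℤ))
    :+ (con (+ 2) :* (z :* (con 1ℤ :- z))) :* (c :- con 0ℤ))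
   ≈-refl z (∑< (term 1# q z) (suc N)) (∑< (term 1# q (z ⊛ q)) (suc N)) (cert 1# q z (suc N))))

V-1⊖ : ∀ d → V (1# ⊖ d) ≈ 1# ⊖ V d
V-1⊖ d = ≈-trans (V-⊕ 1# (⊝ d)) (⊕-cong (V-const 1ℤ) (V-⊝ d))

V-1⊕ : ∀ d → V (1# ⊕ d) ≈ 1# ⊕ V d
V-1⊕ d = ≈-trans (V-⊕ 1# d) (⊕-congʳ (V-const 1ℤ))

-- For a = -1 the boundary value is z - z². Only z² can be absorbed by 2s - 1; the term z is odd in
-- q and is removed by U. This is why the even part of v₀ is taken.
E-recurrence : ∀ N {z d} → z 0 ≡ 0ℤ → U z ≈ 0# → z ⊛ z ≈ V d →
  (1# ⊖ d) ⊛ E (suc (2 * N)) z ≈[ N ] (1# ⊕ d) ⊛ E (suc (2 * N)) (z ⊛ V q)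
E-recurrence N {z} {d} z₀≡0 Uz≈0 z²≈Vd = combine[]
  (const (+ 2) ∙[] even-part)
  (solve 3 (λ d s t →
    (con 1ℤ :- d) :* (con (+ 2) :* s :- con 1ℤ) :- (con 1ℤ :+ d) :* (con (+ 2) :* t :- con 1ℤ)
    := con (+ 2) :* (((con 1ℤ :- d) :* s :- (con 1ℤ :+ d) :* t) :- (:- d)))
   ≈-refl d (U s) (U t))
  where
  a = const -1ℤ
  -- U halves exponents: precision N after U needs precision 2N before it, hence 2N + 1 terms.
  s = ∑< (term a (V q) z) (suc (2 * N))
  t = ∑< (term a (V q) (z ⊛ V q)) (suc (2 * N))
  c = cert a (V q) z (suc (2 * N))
  telescoped : V (1# ⊖ d) ⊛ s ⊖ V (1# ⊕ d) ⊛ t ≈[ 2 * N ] z ⊖ V d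
  telescoped = combine[]
    ( 1# ∙[] ≈⇒≈[] (∑-telescopes a (V q) z z₀≡0 (≈-sym (const-* -1ℤ -1ℤ)) (suc (2 * N)))
    ⊞[] (⊝ (z ⊛ (1# ⊖ z))) ∙[] cert-order a (V q) z z₀≡0 (V-coeff0 q) (2 * N)
    ⊞[] (s ⊕ t ⊖ 1#) ∙[] ≈⇒≈[] z²≈Vd
    ⊞[] s ∙[] ≈⇒≈[] (V-1⊖ d)
    ⊞[] (⊝ t) ∙[] ≈⇒≈[] (V-1⊕ d) )
    (solve 7 (λ z s t c vd m p →
      (m :* s :- p :* t) :- (z :- vd)
      := con 1ℤ :* (((con 1ℤ :- z) :* (con 1ℤ :- con -1ℤ :* z) :* s :- (con 1ℤ :- con -1ℤ :* (z :* z)) :* t)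
           :- con -1ℤ :* z :* (con 1ℤ :- z) :* (c :- con 1ℤ))
      :+ (:- (z :* (con 1ℤ :- z)) :* (c :- con 0ℤ)
      :+ ((s :+ t :- con 1ℤ) :* (z :* z :- vd)
      :+ (s :* (m :- (con 1ℤ :- vd))
      :+ (:- t) :* (p :- (con 1ℤ :+ vd))))))
     ≈-refl z s t c (V d) (V (1# ⊖ d)) (V (1# ⊕ d)))
  even-part : (1# ⊖ d) ⊛ U s ⊖ (1# ⊕ d) ⊛ U t ≈[ N ] ⊝ d
  even-part = begin
    (1# ⊖ d) ⊛ U s ⊖ (1# ⊕ d) ⊛ U t      ≈⟨ ≈⇒≈[] (⊕-cong (U-V⊛ _ s) (⊝-cong (U-V⊛ _ t))) ⟨
    U (V (1# ⊖ d) ⊛ s) ⊖ U (V (1# ⊕ d) ⊛ t) ≈⟨ ≈⇒≈[] (≈-trans (U-⊕ _ _) (⊕-congˡ (U-⊝ _))) ⟨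
    U (V (1# ⊖ d) ⊛ s ⊖ V (1# ⊕ d) ⊛ t)  ≈⟨ U-cong[] telescoped ⟩
    U (z ⊖ V d)                          ≈⟨ ≈⇒≈[] (≈-trans (U-⊕ _ _) (⊕-cong Uz≈0 (≈-trans (U-⊝ _) (⊝-cong (U-V d))))) ⟩
    0# ⊖ d                               ≈⟨ ≈⇒≈[] (⊕-identityˡ (⊝ d)) ⟩
    ⊝ d                                  ∎
    where open ≈[]-Reasoning N

-- The theta functions φ = Σ_{m∈ℤ} q^{m²} and ψ = Σ_{m≥0} q^{m(m+1)/2}

square? : ∀ n → Dec (∃[ k ] (k < suc n × k * k ≡ n))
square? n = ℕ.anyUpTo? (λ k → k * k ℕ.≟ n) (suc n)

-- The series Σ q^{k²} over k ≥ 0, given by a decidable predicate so that its support is known by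
-- definition; `∑-q^m²` identifies it with the sum.
χ : Series
χ n with square? n
... | yes _ = 1ℤ
... | no  _ = 0ℤ

m≤m² : ∀ m → m ≤ m * m
m≤m² zero    = z≤n
m≤m² (suc m) = ℕ.m≤m*n (suc m) (suc m)

χ-square : ∀ k {n} → k * k ≡ n → χ n ≡ 1ℤ
χ-square k {n} k²≡n with square? n
... | yes _ = refl
... | no ¬sq = ⊥-elim (¬sq (k , s≤s (subst (k ≤_) k²≡n (m≤m² k)) , k²≡n))

χ-nonsquare : ∀ {n} → (∀ k → k * k ≢ n) → χ n ≡ 0ℤ
χ-nonsquare {n} ¬sq with square? n
... | yes (k , _ , k²≡n) = ⊥-elim (¬sq k k²≡n)
... | no _ = refl

data Square : ℕ → Set where
  square-even : ∀ j → Square (2 * (2 * (j * j)))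
  square-odd  : ∀ t → Square (suc (2 * (2 * (2 * t))))

pronic-even : ∀ j → ∃[ t ] j * suc j ≡ 2 * t
pronic-even zero    = 0 , refl
pronic-even (suc j) with pronic-even j
... | t , j[j+1]≡2t = suc j + t ,
  trans (step j) (trans (cong (λ m → 2 * suc j + m) j[j+1]≡2t) (sym (ℕ.*-distribˡ-+ 2 (suc j) t)))
  where
  step : ∀ j → suc j * suc (suc j) ≡ 2 * suc j + j * suc j
  step = ℕ-Solver.solve-∀

square-residue : ∀ k → Square (k * k)
square-residue k with parity k
... | even j = subst Square (lemma j) (square-even j)
  where
  lemma : ∀ j → 2 * (2 * (j * j)) ≡ 2 * j * (2 * j)
  lemma = ℕ-Solver.solve-∀
... | odd j with pronic-even j
...   | t , j[j+1]≡2t = subst Square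
  (trans (cong (λ m → suc (2 * (2 * m))) (sym j[j+1]≡2t)) (lemma j)) (square-odd t)
  where
  lemma : ∀ j → suc (2 * (2 * (j * suc j))) ≡ suc (2 * j) * suc (2 * j)
  lemma = ℕ-Solver.solve-∀

-- ψ n = 1 exactly if 8n + 1 is a square, that is, if n is triangular.
ψ : Series
ψ = U (U (O χ))

φ : Series
φ = const (+ 2) ⊛ χ ⊖ 1#

even-square : ∀ {n k} → k * k ≡ 2 * n → ∃[ j ] n ≡ 2 * (j * j)
even-square {n} {k} eq with k * k | square-residue k
... | _ | square-even j = j , ℕ.*-cancelˡ-≡ n (2 * (j * j)) 2 (sym eq)
... | _ | square-odd t  = ⊥-elim (ℕ.even≢odd n (2 * (2 * t)) (sym eq))

odd-square : ∀ {n k} → k * k ≡ suc (2 * n) → ∃[ t ] n ≡ 2 * (2 * t)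
odd-square {n} {k} eq with k * k | square-residue k
... | _ | square-even j = ⊥-elim (ℕ.even≢odd (2 * (j * j)) n eq)
... | _ | square-odd t  = t , ℕ.*-cancelˡ-≡ n (2 * (2 * t)) 2 (sym (ℕ.suc-injective eq))

χ-4n : ∀ n → χ (2 * (2 * n)) ≡ χ n
χ-4n n with square? n
... | yes (k , _ , k²≡n) = χ-square (2 * k) (trans (lemma k) (cong (λ m → 2 * (2 * m)) k²≡n))
  where
  lemma : ∀ j → 2 * j * (2 * j) ≡ 2 * (2 * (j * j))
  lemma = ℕ-Solver.solve-∀
... | no ¬sq = χ-nonsquare nonsquare
  where
  nonsquare : ∀ k → k * k ≢ 2 * (2 * n)
  nonsquare k eq with even-square {k = k} eq
  ... | j , 2n≡2j² = ¬sq (j , s≤s (subst (j ≤_) j²≡n (m≤m² j)) , j²≡n)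
    where
    j²≡n = ℕ.*-cancelˡ-≡ (j * j) n 2 (sym 2n≡2j²)

opaque
  unfolding U

  ψ-coeff : ∀ n → ψ n ≡ χ (suc (2 * (2 * (2 * n))))
  ψ-coeff n = refl

  U-χ : U χ ≈ V χ
  U-χ = UO-extensional
    (agree λ n → trans (χ-4n n) (sym (V-even χ n)))
    (agree λ n → trans (χ-nonsquare λ k eq → let j , odd≡even = even-square {k = k} eq in
                          ℕ.even≢odd (j * j) n (sym odd≡even))
                       (sym (V-odd χ n)))

  O-χ : O χ ≈ V (V ψ)
  O-χ = UO-extensional
    (≈-trans (UO-extensional (≈-sym (U-V ψ))
        (agree λ n → trans (χ-nonsquare λ k eq → let t , eq′ = odd-square {k = k} eq in
                              ℕ.even≢odd t n (sym (ℕ.*-cancelˡ-≡ (suc (2 * n)) (2 * t) 2 eq′)))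
                           (sym (V-odd ψ n))))
      (≈-sym (U-V (V ψ))))
    (agree λ n → trans (χ-nonsquare λ k eq → let t , eq′ = odd-square {k = k} eq in
                          ℕ.even≢odd (2 * t) n (sym eq′))
                       (sym (V-odd (V ψ) n)))

-- Together with `O-φ` this is the dissection φ(q) = φ(q⁴) + 2q ψ(q⁸): even squares are 4j² and odd
-- squares are 1 modulo 8.
U-φ : U φ ≈ V φ
U-φ = begin
  U (const (+ 2) ⊛ χ ⊖ 1#)          ≈⟨ ≈-trans (U-⊕ _ _) (⊕-cong (U-const⊛ (+ 2) χ) (≈-trans (U-⊝ 1#) (⊝-cong (U-const 1ℤ)))) ⟩
  const (+ 2) ⊛ U χ ⊖ 1#            ≈⟨ ⊕-congʳ (⊛-congˡ U-χ) ⟩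
  const (+ 2) ⊛ V χ ⊖ 1#            ≈⟨ ⊕-cong (⊛-congʳ (V-const (+ 2))) (⊝-cong (V-const 1ℤ)) ⟨
  V (const (+ 2)) ⊛ V χ ⊖ V 1#      ≈⟨ ⊕-cong (V-⊛ (const (+ 2)) χ) (V-⊝ 1#) ⟨
  V (const (+ 2) ⊛ χ) ⊕ V (⊝ 1#)    ≈⟨ V-⊕ _ _ ⟨
  V φ                               ∎
  where open ≈-Reasoning

O-φ : O φ ≈ const (+ 2) ⊛ V (V ψ)
O-φ = begin
  O (const (+ 2) ⊛ χ ⊖ 1#)          ≈⟨ ≈-trans (O-⊕ _ _) (⊕-cong (O-const⊛ (+ 2) χ) (≈-trans (O-⊝ 1#) (⊝-cong (O-const 1ℤ)))) ⟩
  const (+ 2) ⊛ O χ ⊖ 0#            ≈⟨ ⊕-cong (⊛-congˡ O-χ) (≈-trans (⊝-cong (≈-sym const-0)) (≈-sym (const-⊝ 0ℤ))) ⟩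
  const (+ 2) ⊛ V (V ψ) ⊕ const 0ℤ  ≈⟨ solve 1 (λ x → x :+ con 0ℤ := x) ≈-refl _ ⟩
  const (+ 2) ⊛ V (V ψ)             ∎
  where open ≈-Reasoning

opaque
  unfolding _⊕_

  q⊛-zero : ∀ f → (q ⊛ f) 0 ≡ 0ℤ
  q⊛-zero f = refl

  ∑<-coeff : ∀ f M n → ∑< f M n ≡ ∑[ i < M ] f (toℕ i) n
  ∑<-coeff f zero    n = refl
  ∑<-coeff f (suc M) n = trans (cong (ℤ._+ f M n) (∑<-coeff f M n)) (snoc (λ m → f m n) M)
    where
    snoc : ∀ (g : ℕ → ℤ) M → (∑[ i < M ] g (toℕ i)) ℤ.+ g M ≡ ∑[ i < suc M ] g (toℕ i)
    snoc g zero    = ℤ.+-comm 0ℤ (g 0)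
    snoc g (suc M) = trans (ℤ.+-assoc (g 0) _ _) (cong (λ s → g 0 ℤ.+ s) (snoc (λ m → g (suc m)) M))

  1#-suc : ∀ n → 1# (suc n) ≡ 0ℤ
  1#-suc n = refl

q^-coeff-≡ : ∀ n → (q ^ˢ n) n ≡ 1ℤ
q^-coeff-≡ zero    = const-coeff0 1ℤ
q^-coeff-≡ (suc n) = trans (q⊛-suc (q ^ˢ n) n) (q^-coeff-≡ n)

q^-coeff-≢ : ∀ k n → k ≢ n → (q ^ˢ k) n ≡ 0ℤ
q^-coeff-≢ zero    zero    k≢n = ⊥-elim (k≢n refl)
q^-coeff-≢ zero    (suc n) k≢n = 1#-suc n
q^-coeff-≢ (suc k) zero    k≢n = q⊛-zero _
q^-coeff-≢ (suc k) (suc n) k≢n = trans (q⊛-suc (q ^ˢ k) n) (q^-coeff-≢ k n (λ k≡n → k≢n (cong suc k≡n)))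

∑<-zero : ∀ f M n → (∀ m → m < M → f m n ≡ 0ℤ) → ∑< f M n ≡ 0ℤ
∑<-zero f zero    n f≡0 = 0#-coeff n
∑<-zero f (suc M) n f≡0 = trans (⊕-coeff (∑< f M) (f M) n)
  (cong₂ ℤ._+_ (∑<-zero f M n (λ m m<M → f≡0 m (ℕ.m<n⇒m<1+n m<M))) (f≡0 M (ℕ.n<1+n M)))

∑<-single : ∀ f M n k → k < M → (∀ m → m ≢ k → f m n ≡ 0ℤ) → ∑< f M n ≡ f k n
∑<-single f (suc M) n k k<1+M f≡0 with k ℕ.≟ M
... | yes refl = trans (⊕-coeff (∑< f M) (f M) n)
  (trans (cong (ℤ._+ f M n) (∑<-zero f M n (λ m m<M → f≡0 m (ℕ.<⇒≢ m<M)))) (ℤ.+-identityˡ _))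
... | no k≢M = trans (⊕-coeff (∑< f M) (f M) n)
  (trans (cong₂ ℤ._+_ (∑<-single f M n k (ℕ.≤∧≢⇒< (ℕ.≤-pred k<1+M) k≢M) f≡0) (f≡0 M (λ M≡k → k≢M (sym M≡k))))
    (ℤ.+-identityʳ _))

-- Since m ≤ m², the root of a square below M is itself below M and is met by the sum, exactly once.
∑-q^m² : ∀ M → ∑< (λ m → q ^ˢ (m * m)) M ≈[ M ] χ
∑-q^m² M = agree λ n n<M → at n n<M
  where
  m²-injective : ∀ m k → m * m ≡ k * k → m ≡ k
  m²-injective m k m²≡k² with ℕ.<-cmp m k
  ... | tri< m<k _ _ = ⊥-elim (ℕ.<⇒≢ (ℕ.*-mono-< m<k m<k) m²≡k²)
  ... | tri≈ _ m≡k _ = m≡k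
  ... | tri> _ _ k<m = ⊥-elim (ℕ.<⇒≢ (ℕ.*-mono-< k<m k<m) (sym m²≡k²))
  at : ∀ n → n < M → ∑< (λ m → q ^ˢ (m * m)) M n ≡ χ n
  at n n<M with square? n
  ... | yes (k , k≤n , refl) = trans
    (∑<-single _ M n k (ℕ.<-≤-trans k≤n n<M)
      (λ m m≢k → q^-coeff-≢ (m * m) n (λ m²≡k² → m≢k (m²-injective m k m²≡k²))))
    (q^-coeff-≡ n)
  ... | no ¬sq = ∑<-zero _ M n (λ m m<M → q^-coeff-≢ (m * m) n
    (λ m²≡n → ¬sq (m , s≤s (subst (m ≤_) m²≡n (m≤m² m)) , m²≡n)))

-- v₀ as the sum of terms

opaque
  unfolding _⊕_

  D⊛≈⊛ : ∀ f g → f D.⊛ g ≈ f ⊛ g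
  D⊛≈⊛ f g = agree λ _ → refl

  D⊖≈⊖ : ∀ f g → f D.⊖ g ≈ f ⊖ g
  D⊖≈⊖ f g = agree λ _ → refl

  D⊝≈⊝ : ∀ f → D.⊝ f ≈ ⊝ f
  D⊝≈⊝ f = agree λ _ → refl

D^≈^ˢ : ∀ f n → f D.^ n ≈ f ^ˢ n
D^≈^ˢ f zero    = D1#≈1#
D^≈^ˢ f (suc n) = ≈-trans (D⊛≈⊛ f (f D.^ n)) (⊛-congˡ (D^≈^ˢ f n))

q²≈Vq : q D.^ 2 ≈ V q
q²≈Vq = ≈-trans (D^≈^ˢ q 2) (≈-trans (⊛-congˡ (⊛-identityʳ q)) (≈-sym V-q))

pochhammer-suc : ∀ {a a′} → a ≈ a′ → ∀ n →
  D.pochhammer a (q D.^ 2) (suc n) ≈ D.pochhammer a (q D.^ 2) n ⊛ (1# ⊖ a′ ⊛ V q ^ˢ n)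
pochhammer-suc {a} a≈a′ n = ≈-trans (D⊛≈⊛ _ _) (⊛-congˡ (≈-trans (D⊖≈⊖ _ _)
  (⊕-cong D1#≈1# (⊝-cong (≈-trans (D⊛≈⊛ a _)
    (⊛-cong a≈a′ (≈-trans (D^≈^ˢ (q D.^ 2) n) (^ˢ-congˡ n q²≈Vq))))))))

Vq^≈ : ∀ m → V q ^ˢ m ≈ q ^ˢ m ⊛ q ^ˢ m
Vq^≈ zero    = ≈-sym (⊛-identityˡ 1#)
Vq^≈ (suc m) = ≈-trans (⊛-cong V-q (Vq^≈ m))
  (solve 2 (λ q y → (q :* q) :* (y :* y) := (q :* y) :* (q :* y)) ≈-refl q (q ^ˢ m))

q^-square-suc : ∀ m → q ^ˢ (m * m) ⊛ (q ^ˢ m ⊛ q ^ˢ suc m) ≈ q ^ˢ (suc m * suc m)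
q^-square-suc m = begin
  q ^ˢ (m * m) ⊛ (q ^ˢ m ⊛ q ^ˢ suc m)  ≈⟨ ⊛-congˡ (^ˢ-+ q m (suc m)) ⟨
  q ^ˢ (m * m) ⊛ q ^ˢ (m + suc m)       ≈⟨ ^ˢ-+ q (m * m) (m + suc m) ⟨
  q ^ˢ (m * m + (m + suc m))            ≡⟨ cong (q ^ˢ_) (lemma m) ⟩
  q ^ˢ (suc m * suc m)                  ∎
  where
  open ≈-Reasoning
  lemma : ∀ m → m * m + (m + suc m) ≡ suc m * suc m
  lemma = ℕ-Solver.solve-∀

-- At a = -1, b = q², z = q the step from m to m + 1 contributes q^{2m} (q + q^{2m+2}) = q^{2m+1} (1
-- + q^{2m+1}), and the odd powers of q accumulate to q^{m²}. `term` inverts its denominator factor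
-- by factor and `v₀-summand` inverts the whole product, so the comparison is made after multiplying
-- by that product.
term⊛pochhammer : ∀ m → term (const -1ℤ) (V q) q m ⊛ D.pochhammer q (q D.^ 2) m
  ≈ q ^ˢ (m * m) ⊛ D.pochhammer (D.⊝ q) (q D.^ 2) m
term⊛pochhammer zero = ⊛-congˡ ≈-refl
term⊛pochhammer (suc m) = combine
  ( (term (const -1ℤ) (V q) q (suc m)) ∙ pochhammer-suc {q} ≈-refl m
  ⊞ (⊝ (q ^ˢ (suc m * suc m))) ∙ pochhammer-suc (D⊝≈⊝ q) m
  ⊞ (n ⊛ (1# ⊖ (⊝ q) ⊛ x)) ∙ q^-square-suc m
  ⊞ (w ⊛ p ⊛ (x ⊛ (q ⊖ const -1ℤ ⊛ (v ⊛ x)))) ∙ denom-inverse (const -1ℤ) (V q) q refl m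
  ⊞ (x ⊛ (q ⊖ const -1ℤ ⊛ (v ⊛ x))) ∙ term⊛pochhammer m
  ⊞ (x ⊛ (x ⊛ (r ⊛ n))) ∙ V-q
  ⊞ (q ⊛ ((1# ⊕ q ⊛ x) ⊛ (r ⊛ n))) ∙ Vq^≈ m )
  (solve 12 (λ w p p′ n n′ x v i y r r′ q →
    let w′ = w :* (x :* ((q :- con -1ℤ :* (v :* x)) :* i)) in
    w′ :* p′ :- r′ :* n′
    := w′ :* (p′ :- p :* (con 1ℤ :- q :* x))
    :+ ((:- r′) :* (n′ :- n :* (con 1ℤ :- (:- q) :* x))
    :+ ((n :* (con 1ℤ :- (:- q) :* x)) :* (r :* (y :* (q :* y)) :- r′)
    :+ ((w :* p :* (x :* (q :- con -1ℤ :* (v :* x)))) :* ((con 1ℤ :- q :* x) :* i :- con 1ℤ)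
    :+ ((x :* (q :- con -1ℤ :* (v :* x))) :* (w :* p :- r :* n)
    :+ ((x :* (x :* (r :* n))) :* (v :- q :* q)
    :+ (q :* ((con 1ℤ :+ q :* x) :* (r :* n))) :* (x :- y :* y)))))))
   ≈-refl w p (D.pochhammer q (q D.^ 2) (suc m)) n (D.pochhammer (D.⊝ q) (q D.^ 2) (suc m))
     x v i y r (q ^ˢ (suc m * suc m)) q)
  where
  w = term (const -1ℤ) (V q) q m
  p = D.pochhammer q (q D.^ 2) m
  n = D.pochhammer (D.⊝ q) (q D.^ 2) m
  x = V q ^ˢ m
  v = V q
  i = denom⁻¹ (V q) q m
  y = q ^ˢ m
  r = q ^ˢ (m * m)

term≈v₀-summand : ∀ m → term (const -1ℤ) (V q) q m ≈ D.v₀-summand m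
term≈v₀-summand m = ≈-trans
  (combine (p⁻¹ ∙ term⊛pochhammer m ⊞ (⊝ w) ∙ ⁻¹-inverse p (D.pochhammer-q-const (q D.^ 2) m))
    (solve 5 (λ w p j r n → w :- r :* n :* j := j :* (w :* p :- r :* n) :+ (:- w) :* (p :* j :- con 1ℤ))
      ≈-refl w p p⁻¹ (q ^ˢ (m * m)) n))
  (≈-sym (≈-trans (D⊛≈⊛ _ p⁻¹) (⊛-congʳ (≈-trans (D⊛≈⊛ _ n) (⊛-congʳ (D^≈^ˢ q (m * m)))))))
  where
  w = term (const -1ℤ) (V q) q m
  p = D.pochhammer q (q D.^ 2) m
  p⁻¹ = p D.⁻¹
  n = D.pochhammer (D.⊝ q) (q D.^ 2) m

v₀≈∑<-summand : ∀ M → v₀ ≈[ M ] ∑< D.v₀-summand M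
v₀≈∑<-summand zero    = agree λ _ ()
v₀≈∑<-summand (suc M) = agree λ n n<1+M → at n (ℕ.m≤n⇒m<n∨m≡n (ℕ.≤-pred n<1+M))
  where
  at : ∀ n → n < M ⊎ n ≡ M → v₀ n ≡ ∑< D.v₀-summand (suc M) n
  at n (inj₂ refl) = sym (∑<-coeff D.v₀-summand (suc M) n)
  at n (inj₁ n<M)  = sym (trans (⊕-coeff (∑< D.v₀-summand M) (D.v₀-summand M) n)
    (trans (cong₂ ℤ._+_ (sym (coeff< (v₀≈∑<-summand M) n n<M)) (D.v₀-summand-order M n n<M)) (ℤ.+-identityʳ _)))

v₀≈∑<-term : ∀ M → v₀ ≈[ M ] ∑< (term (const -1ℤ) (V q) q) M
v₀≈∑<-term M = ≈[]-trans (v₀≈∑<-summand M) (≈[]-sym (∑<-cong[] (λ m → ≈⇒≈[] (term≈v₀-summand m)) M))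

-- Limits along z = q, q², q³, …, and the resulting product formulas

∑<-hom : ∀ (F : Series → Series) → F 0# ≈ 0# → (∀ f g → F (f ⊕ g) ≈ F f ⊕ F g) →
  ∀ f M → F (∑< f M) ≈ ∑< (λ m → F (f m)) M
∑<-hom F F0 F⊕ f zero    = F0
∑<-hom F F0 F⊕ f (suc M) = ≈-trans (F⊕ _ _) (⊕-congʳ (∑<-hom F F0 F⊕ f M))

opaque
  unfolding _⊕_ U

  U-0# : U 0# ≈ 0#
  U-0# = agree λ _ → refl

σ-0# : σ 0# ≈ 0#
σ-0# = ≈-trans (σ-cong (≈-sym const-0)) (≈-trans (σ-const 0ℤ) const-0)

σ-σ : ∀ f → σ (σ f) ≈ f
σ-σ f = UO-extensional (≈-trans (U-σ (σ f)) (U-σ f))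
  (≈-trans (O-σ (σ f)) (≈-trans (⊝-cong (O-σ f)) (solve 1 (λ x → :- (:- x) := x) ≈-refl (O f))))

σ-q^ : ∀ m → σ (q ^ˢ m) ⊛ σ (q ^ˢ suc m) ≈ ⊝ (q ^ˢ m ⊛ q ^ˢ suc m)
σ-q^ zero = begin
  σ 1# ⊛ σ (q ⊛ 1#)  ≈⟨ ⊛-cong (σ-const 1ℤ) (≈-trans (σ-cong (⊛-identityʳ q)) σ-q) ⟩
  1# ⊛ (⊝ q)         ≈⟨ solve 1 (λ q → con 1ℤ :* :- q := :- (con 1ℤ :* (q :* con 1ℤ))) ≈-refl q ⟩
  ⊝ (1# ⊛ (q ⊛ 1#))  ∎
  where open ≈-Reasoning
σ-q^ (suc m) = begin
  σ (q ⊛ y) ⊛ σ (q ⊛ (q ⊛ y))            ≈⟨ ⊛-cong (≈-trans (σ-⊛ q y) (⊛-congʳ σ-q)) (≈-trans (σ-⊛ q (q ⊛ y)) (⊛-congʳ σ-q)) ⟩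
  ((⊝ q) ⊛ σ y) ⊛ ((⊝ q) ⊛ σ (q ⊛ y))    ≈⟨ solve 3 (λ q a b → (:- q :* a) :* (:- q :* b) := q :* q :* (a :* b)) ≈-refl q (σ y) (σ (q ⊛ y)) ⟩
  q ⊛ q ⊛ (σ y ⊛ σ (q ⊛ y))              ≈⟨ ⊛-congˡ (σ-q^ m) ⟩
  q ⊛ q ⊛ (⊝ (y ⊛ (q ⊛ y)))              ≈⟨ solve 2 (λ q y → q :* q :* (:- (y :* (q :* y))) := :- (q :* y :* (q :* (q :* y)))) ≈-refl q y ⟩
  ⊝ (q ⊛ y ⊛ (q ⊛ (q ⊛ y)))              ∎
  where open ≈-Reasoning
        y = q ^ˢ m

-- For a = 1, b = q the limit is (-1)^m q^{m²}, and q ↦ -q removes the sign because m² and m have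
-- the same parity.
σ-limit : ∀ m → σ (limit 1# q m) ≈ q ^ˢ (m * m)
σ-limit zero    = σ-const 1ℤ
σ-limit (suc m) = begin
  σ (l ⊛ (y ⊛ ⊝ (1# ⊛ y′)))           ≈⟨ σ-cong (solve 3 (λ l y z → l :* (y :* :- (con 1ℤ :* z)) := :- (l :* (y :* z))) ≈-refl l y y′) ⟩
  σ (⊝ (l ⊛ (y ⊛ y′)))                ≈⟨ ≈-trans (σ-⊝ _) (⊝-cong (≈-trans (σ-⊛ l (y ⊛ y′)) (⊛-cong (σ-limit m) (≈-trans (σ-⊛ y y′) (σ-q^ m))))) ⟩
  ⊝ (q ^ˢ (m * m) ⊛ ⊝ (y ⊛ y′))       ≈⟨ solve 2 (λ a b → :- (a :* :- b) := a :* b) ≈-refl (q ^ˢ (m * m)) (y ⊛ y′) ⟩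
  q ^ˢ (m * m) ⊛ (y ⊛ y′)             ≈⟨ q^-square-suc m ⟩
  q ^ˢ (suc m * suc m)                ∎
  where open ≈-Reasoning
        l = limit 1# q m
        y = q ^ˢ m
        y′ = q ^ˢ suc m

V-^ : ∀ m → V q ^ˢ m ≈ V (q ^ˢ m)
V-^ zero    = ≈-sym (V-const 1ℤ)
V-^ (suc m) = ≈-trans (⊛-congˡ (V-^ m)) (≈-sym (V-⊛ q (q ^ˢ m)))

limit-V : ∀ m → limit (const -1ℤ) (V q) m ≈ V (q ^ˢ (m * m))
limit-V zero    = ≈-sym (V-const 1ℤ)
limit-V (suc m) = begin
  limit (const -1ℤ) (V q) m ⊛ (V q ^ˢ m ⊛ ⊝ (const -1ℤ ⊛ V q ^ˢ suc m))
    ≈⟨ ⊛-cong (limit-V m) (solve 2 (λ a b → a :* :- (con -1ℤ :* b) := a :* b) ≈-refl (V q ^ˢ m) (V q ^ˢ suc m)) ⟩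
  V (q ^ˢ (m * m)) ⊛ (V q ^ˢ m ⊛ V q ^ˢ suc m)
    ≈⟨ ⊛-congˡ (≈-trans (⊛-cong (V-^ m) (V-^ (suc m))) (≈-sym (V-⊛ _ _))) ⟩
  V (q ^ˢ (m * m)) ⊛ V (q ^ˢ m ⊛ q ^ˢ suc m)
    ≈⟨ V-⊛ _ _ ⟨
  V (q ^ˢ (m * m) ⊛ (q ^ˢ m ⊛ q ^ˢ suc m))
    ≈⟨ V-cong (q^-square-suc m) ⟩
  V (q ^ˢ (suc m * suc m)) ∎
  where open ≈-Reasoning

φ-limit : ∀ M → const (+ 2) ⊛ ∑< (λ m → q ^ˢ (m * m)) M ⊖ 1# ≈[ M ] φ
φ-limit M = ⊕-cong[] (⊛-cong[] ≈[]-refl (∑-q^m² M)) ≈[]-refl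

T-limit : ∀ N {z} → z 0 ≡ 0ℤ → z ≈[ N ] 0# → σ (T (suc N) z) ≈[ N ] φ
T-limit N {z} z₀≡0 z≈0 = begin
  σ (const (+ 2) ⊛ ∑< (term 1# q z) (suc N) ⊖ 1#)
    ≈⟨ ≈⇒≈[] (≈-trans (σ-⊕ _ _) (⊕-cong (≈-trans (σ-⊛ _ _) (⊛-cong (σ-const (+ 2))
         (∑<-hom σ σ-0# σ-⊕ _ (suc N)))) (≈-trans (σ-⊝ 1#) (⊝-cong (σ-const 1ℤ))))) ⟩
  const (+ 2) ⊛ ∑< (λ m → σ (term 1# q z m)) (suc N) ⊖ 1#
    ≈⟨ ⊕-cong[] (⊛-cong[] ≈[]-refl (∑<-cong[] (λ m → ≈[]-trans (σ-cong[] (term-limit 1# q z z₀≡0 z≈0 m))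
         (≈⇒≈[] (σ-limit m))) (suc N))) ≈[]-refl ⟩
  const (+ 2) ⊛ ∑< (λ m → q ^ˢ (m * m)) (suc N) ⊖ 1#
    ≈⟨ ≈[]-weaken (ℕ.n≤1+n N) (φ-limit (suc N)) ⟩
  φ ∎
  where open ≈[]-Reasoning N

E-limit : ∀ N {z} → z 0 ≡ 0ℤ → z ≈[ 2 * N ] 0# → E (suc (2 * N)) z ≈[ N ] φ
E-limit N {z} z₀≡0 z≈0 = begin
  const (+ 2) ⊛ U (∑< (term (const -1ℤ) (V q) z) M) ⊖ 1#
    ≈⟨ ≈⇒≈[] (⊕-congʳ (⊛-congˡ (∑<-hom U U-0# U-⊕ _ M))) ⟩
  const (+ 2) ⊛ ∑< (λ m → U (term (const -1ℤ) (V q) z m)) M ⊖ 1#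
    ≈⟨ ⊕-cong[] (⊛-cong[] ≈[]-refl (∑<-cong[] (λ m → ≈[]-trans
         (U-cong[] (term-limit (const -1ℤ) (V q) z z₀≡0 z≈0 m))
         (≈⇒≈[] (≈-trans (U-cong (limit-V m)) (U-V _)))) M)) ≈[]-refl ⟩
  const (+ 2) ⊛ ∑< (λ m → q ^ˢ (m * m)) M ⊖ 1#
    ≈⟨ ≈[]-weaken (ℕ.≤-trans (ℕ.m≤n*m N 2) (ℕ.n≤1+n _)) (φ-limit M) ⟩
  φ ∎
  where open ≈[]-Reasoning N
        M = suc (2 * N)

-- xs j = ss j = q^{2j+1} and ys j = q^{j+1}; ss is stepped by the base q² of
-- E, whereas xs takes two steps by the base q of T.
xs ys ss : ℕ → Series
xs zero    = q
xs (suc j) = xs j ⊛ q ⊛ q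
ys zero    = q
ys (suc j) = ys j ⊛ q
ss zero    = q
ss (suc j) = ss j ⊛ V q

⊛₀≡0 : ∀ {f} g → f 0 ≡ 0ℤ → (f ⊛ g) 0 ≡ 0ℤ
⊛₀≡0 {f} g f₀≡0 = trans (⊛-coeff0 f g) (cong (ℤ._* g 0) f₀≡0)

xs₀≡0 : ∀ j → xs j 0 ≡ 0ℤ
xs₀≡0 zero    = refl
xs₀≡0 (suc j) = ⊛₀≡0 q (⊛₀≡0 q (xs₀≡0 j))

ys₀≡0 : ∀ j → ys j 0 ≡ 0ℤ
ys₀≡0 zero    = refl
ys₀≡0 (suc j) = ⊛₀≡0 q (ys₀≡0 j)

ss₀≡0 : ∀ j → ss j 0 ≡ 0ℤ
ss₀≡0 zero    = refl
ss₀≡0 (suc j) = ⊛₀≡0 (V q) (ss₀≡0 j)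

⊛-order-suc : ∀ {N f g} → g 0 ≡ 0ℤ → f ≈[ N ] 0# → f ⊛ g ≈[ suc N ] 0#
⊛-order-suc {N} {f} {g} g₀≡0 f≈0 = ≈[]-trans (≈⇒≈[] (⊛-comm f g))
  (⊛-order {1} {N} (agree λ { zero _ → trans g₀≡0 (sym (0#-coeff 0)) ; (suc _) (s≤s ()) }) f≈0)

xs-order : ∀ j → xs j ≈[ j ] 0#
xs-order zero    = agree λ _ ()
xs-order (suc j) = ⊛-orderˡ q (⊛-order-suc refl (xs-order j))

ys-order : ∀ j → ys j ≈[ j ] 0#
ys-order zero    = agree λ _ ()
ys-order (suc j) = ⊛-order-suc refl (ys-order j)

ss-order : ∀ j → ss j ≈[ j ] 0#
ss-order zero    = agree λ _ ()
ss-order (suc j) = ⊛-order-suc (V-coeff0 q) (ss-order j)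

-- Supplies the hypothesis z² = V d of `E-recurrence` with d = `xs j`, the very argument at which T
-- is taken, so that their ratios can cancel.
ss² : ∀ j → ss j ⊛ ss j ≈ V (xs j)
ss² zero    = ≈-sym V-q
ss² (suc j) = begin
  ss j ⊛ V q ⊛ (ss j ⊛ V q)    ≈⟨ solve 2 (λ s v → s :* v :* (s :* v) := s :* s :* v :* v) ≈-refl (ss j) (V q) ⟩
  ss j ⊛ ss j ⊛ V q ⊛ V q      ≈⟨ ⊛-congʳ (⊛-congʳ (ss² j)) ⟩
  V (xs j) ⊛ V q ⊛ V q         ≈⟨ ⊛-congʳ (V-⊛ (xs j) q) ⟨
  V (xs j ⊛ q) ⊛ V q           ≈⟨ V-⊛ (xs j ⊛ q) q ⟨
  V (xs j ⊛ q ⊛ q)             ∎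
  where open ≈-Reasoning

U-ss : ∀ j → U (ss j) ≈ 0#
U-ss zero    = U-q
U-ss (suc j) = begin
  U (ss j ⊛ V q)  ≈⟨ ≈-trans (U-cong (⊛-comm (ss j) (V q))) (U-V⊛ q (ss j)) ⟩
  q ⊛ U (ss j)    ≈⟨ ≈-trans (⊛-congˡ (U-ss j)) (⊛-zeroʳ q) ⟩
  0#              ∎
  where open ≈-Reasoning

σ-xs : ∀ j → σ (xs j) ≈ ⊝ xs j
σ-xs zero    = σ-q
σ-xs (suc j) = begin
  σ (xs j ⊛ q ⊛ q)         ≈⟨ ≈-trans (σ-⊛ _ q) (⊛-cong (≈-trans (σ-⊛ _ q) (⊛-cong (σ-xs j) σ-q)) σ-q) ⟩
  (⊝ xs j) ⊛ (⊝ q) ⊛ (⊝ q) ≈⟨ solve 2 (λ x q → (:- x) :* (:- q) :* (:- q) := :- (x :* q :* q)) ≈-refl (xs j) q ⟩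
  ⊝ (xs j ⊛ q ⊛ q)         ∎
  where open ≈-Reasoning

V-ys : ∀ j → V (ys j) ≈ xs j ⊛ q
V-ys zero    = V-q
V-ys (suc j) = begin
  V (ys j ⊛ q)        ≈⟨ ≈-trans (V-⊛ (ys j) q) (⊛-cong (V-ys j) V-q) ⟩
  xs j ⊛ q ⊛ (q ⊛ q)  ≈⟨ solve 2 (λ x q → x :* q :* (q :* q) := x :* q :* q :* q) ≈-refl (xs j) q ⟩
  xs j ⊛ q ⊛ q ⊛ q    ∎
  where open ≈-Reasoning

-- At z = q = a b the first numerator z - a b vanishes, and the sum stops after its first term.
T-initial : ∀ N → T (suc N) q ≈ 1#
T-initial N = ≈-trans (⊕-congʳ (⊛-congˡ (∑-initial N)))
  (solve 0 (con (+ 2) :* con 1ℤ :- con 1ℤ := con 1ℤ) ≈-refl)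
  where
  term-zero : ∀ m → term 1# q q (suc m) ≈ const 0ℤ
  term-zero zero    = solve 2 (λ q i → con 1ℤ :* (con 1ℤ :* ((q :- con 1ℤ :* (q :* con 1ℤ)) :* i)) := con 0ℤ) ≈-refl q (denom⁻¹ q q 0)
  term-zero (suc m) = ≈-trans (⊛-congʳ (term-zero m)) (solve 1 (λ x → con 0ℤ :* x := con 0ℤ) ≈-refl _)
  ∑-initial : ∀ N → ∑< (term 1# q q) (suc N) ≈ 1#
  ∑-initial zero    = ⊕-identityˡ 1#
  ∑-initial (suc N) = ≈-trans (⊕-cong (∑-initial N) (term-zero N))
    (solve 0 (con 1ℤ :+ con 0ℤ := con 1ℤ) ≈-refl)

-- Product formulas by comparison of recurrences

module _ (N : ℕ) where
  private
    T′ E′ : Series → Series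
    T′ = T (suc N)
    E′ = E (suc (2 * N))

  -- Used for odd arguments `xs j` with w = -z, which inverts the ratio of T, and for even arguments
  -- `xs j ⊛ q` with w = z, which preserves it.
  σ-T-recurrence : ∀ {z w} → z 0 ≡ 0ℤ → σ z ≈ w →
    (1# ⊖ w) ⊛ σ (T′ z) ≈[ N ] (1# ⊕ w) ⊛ σ (T′ (z ⊛ q))
  σ-T-recurrence {z} {w} z₀≡0 σz≈w = begin
    (1# ⊖ w) ⊛ σ (T′ z)          ≈⟨ ≈⇒≈[] (⊛-congʳ (≈-trans (σ-⊕ 1# (⊝ z)) (⊕-cong (σ-const 1ℤ) (≈-trans (σ-⊝ z) (⊝-cong σz≈w))))) ⟨
    σ (1# ⊖ z) ⊛ σ (T′ z)        ≈⟨ ≈⇒≈[] (σ-⊛ _ _) ⟨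
    σ ((1# ⊖ z) ⊛ T′ z)          ≈⟨ σ-cong[] (T-recurrence N z₀≡0) ⟩
    σ ((1# ⊕ z) ⊛ T′ (z ⊛ q))    ≈⟨ ≈⇒≈[] (σ-⊛ _ _) ⟩
    σ (1# ⊕ z) ⊛ σ (T′ (z ⊛ q))  ≈⟨ ≈⇒≈[] (⊛-congʳ (≈-trans (σ-⊕ 1# z) (⊕-cong (σ-const 1ℤ) σz≈w))) ⟩
    (1# ⊕ w) ⊛ σ (T′ (z ⊛ q))    ∎
    where open ≈[]-Reasoning N

  V-T-recurrence : ∀ {z w} → z 0 ≡ 0ℤ → V z ≈ w →
    (1# ⊖ w) ⊛ V (T′ z) ≈[ N ] (1# ⊕ w) ⊛ V (T′ (z ⊛ q))
  V-T-recurrence {z} {w} z₀≡0 Vz≈w = begin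
    (1# ⊖ w) ⊛ V (T′ z)          ≈⟨ ≈⇒≈[] (⊛-congʳ (≈-trans (V-1⊖ z) (⊕-congˡ (⊝-cong Vz≈w)))) ⟨
    V (1# ⊖ z) ⊛ V (T′ z)        ≈⟨ ≈⇒≈[] (V-⊛ _ _) ⟨
    V ((1# ⊖ z) ⊛ T′ z)          ≈⟨ V-cong[] (T-recurrence N z₀≡0) ⟩
    V ((1# ⊕ z) ⊛ T′ (z ⊛ q))    ≈⟨ ≈⇒≈[] (V-⊛ _ _) ⟩
    V (1# ⊕ z) ⊛ V (T′ (z ⊛ q))  ≈⟨ ≈⇒≈[] (⊛-congʳ (≈-trans (V-1⊕ z) (⊕-congˡ Vz≈w))) ⟩
    (1# ⊕ w) ⊛ V (T′ (z ⊛ q))    ∎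
    where open ≈[]-Reasoning N

  -- The factors (1 - x²)(1 + c) clear the denominators in the inductive step of `E-product`, and
  -- `unit₂` those of `T-product`. The sum 1 + c is spelled `1# ⊖ ⊝ c` to fit `1⊖₀≡1`.
  unit₁ : ∀ j → ((1# ⊖ xs j ⊛ xs j) ⊛ (1# ⊖ ⊝ (xs j ⊛ q))) 0 ≡ 1ℤ
  unit₁ j = trans (⊛-coeff0 _ _) (cong₂ ℤ._*_ (1⊖-coeff0 (xs j) (xs j) (xs₀≡0 j))
    (1⊖₀≡1 (trans (⊝-coeff0 _) (cong ℤ.-_ (⊛₀≡0 q (xs₀≡0 j))))))

  unit₂ : ∀ j → ((1# ⊖ xs j ⊛ xs j) ⊛ (1# ⊖ ⊝ (xs j ⊛ q)) ⊛ (1# ⊖ ⊝ (xs j ⊛ q))) 0 ≡ 1ℤ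
  unit₂ j = trans (⊛-coeff0 _ _) (cong₂ ℤ._*_ (unit₁ j)
    (1⊖₀≡1 (trans (⊝-coeff0 _) (cong ℤ.-_ (⊛₀≡0 q (xs₀≡0 j))))))

  σ-xs⊛q : ∀ j → σ (xs j ⊛ q) ≈ xs j ⊛ q
  σ-xs⊛q j = ≈-trans (σ-⊛ (xs j) q) (≈-trans (⊛-cong (σ-xs j) σ-q)
    (solve 2 (λ x q → (:- x) :* (:- q) := x :* q) ≈-refl (xs j) q))

  -- With x = `xs j` and c = x q, a step multiplies the E-factor by (1 - x)/(1 + x) and the
  -- σT-factor by (1 + x)/(1 - x) · (1 - c)/(1 + c). What is left, (1 - c)/(1 + c), is the ratio of
  -- the right-hand side, and both sides agree at j = 0 by `T-initial`.
  E-product : ∀ j → E′ (ss j) ⊛ σ (T′ (xs j)) ≈[ N ] E′ q ⊛ V (T′ (ys j))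
  E-product zero = ⊛-cong[] ≈[]-refl (≈⇒≈[] (≈-trans
    (≈-trans (σ-cong (T-initial N)) (σ-const 1ℤ)) (≈-sym (≈-trans (V-cong (T-initial N)) (V-const 1ℤ)))))
  E-product (suc j) = ⊛-cancelˡ[] (unit₁ j) (combine[]
    ( (⊝ ((1# ⊖ x) ⊛ ((1# ⊕ c) ⊛ S₂))) ∙[] E-recurrence N (ss₀≡0 j) (U-ss j) (ss² j)
    ⊞[] (⊝ ((1# ⊖ x) ⊛ ((1# ⊖ x) ⊛ e))) ∙[] σ-T-recurrence (⊛₀≡0 q (xs₀≡0 j)) (σ-xs⊛q j)
    ⊞[] (⊝ ((1# ⊖ x) ⊛ ((1# ⊖ c) ⊛ e))) ∙[] σ-T-recurrence (xs₀≡0 j) (σ-xs j)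
    ⊞[] ((1# ⊖ x) ⊛ ((1# ⊕ x) ⊛ (1# ⊖ c))) ∙[] E-product j
    ⊞[] ((1# ⊖ x) ⊛ ((1# ⊕ x) ⊛ E′ q)) ∙[] V-T-recurrence (ys₀≡0 j) (V-ys j) )
    (solve 10 (λ x c e e′ e₀ s s₁ s₂ v v′ →
      (con 1ℤ :- x :* x) :* (con 1ℤ :- :- c) :* (e′ :* s₂) :- (con 1ℤ :- x :* x) :* (con 1ℤ :- :- c) :* (e₀ :* v′)
      := (:- ((con 1ℤ :- x) :* ((con 1ℤ :+ c) :* s₂))) :* ((con 1ℤ :- x) :* e :- (con 1ℤ :+ x) :* e′)
      :+ ((:- ((con 1ℤ :- x) :* ((con 1ℤ :- x) :* e))) :* ((con 1ℤ :- c) :* s₁ :- (con 1ℤ :+ c) :* s₂)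
      :+ ((:- ((con 1ℤ :- x) :* ((con 1ℤ :- c) :* e))) :* ((con 1ℤ :- :- x) :* s :- (con 1ℤ :+ :- x) :* s₁)
      :+ (((con 1ℤ :- x) :* ((con 1ℤ :+ x) :* (con 1ℤ :- c))) :* (e :* s :- e₀ :* v)
      :+ ((con 1ℤ :- x) :* ((con 1ℤ :+ x) :* e₀)) :* ((con 1ℤ :- c) :* v :- (con 1ℤ :+ c) :* v′)))))
     ≈-refl x c e (E′ (ss (suc j))) (E′ q) (σ (T′ x)) (σ (T′ c)) S₂ (V (T′ (ys j))) (V (T′ (ys (suc j))))))
    where
    x = xs j
    c = xs j ⊛ q
    e = E′ (ss j)
    S₂ = σ (T′ (xs (suc j)))

  -- At the odd argument x the ratios of T and σT are inverse to each other and cancel; at the even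
  -- argument c they coincide, and their square is the ratio of the right-hand side.
  T-product : ∀ j → T′ (xs j) ⊛ σ (T′ (xs j)) ≈[ N ] V (T′ (ys j)) ⊛ V (T′ (ys j))
  T-product zero = ≈⇒≈[] (⊛-cong
    (≈-trans (T-initial N) (≈-sym (≈-trans (V-cong (T-initial N)) (V-const 1ℤ))))
    (≈-trans (≈-trans (σ-cong (T-initial N)) (σ-const 1ℤ)) (≈-sym (≈-trans (V-cong (T-initial N)) (V-const 1ℤ)))))
  T-product (suc j) = ⊛-cancelˡ[] (unit₂ j) (combine[]
    ( (⊝ (a ⊛ ((1# ⊕ c) ⊛ S₂))) ∙[] T-recurrence N (⊛₀≡0 q (xs₀≡0 j))
    ⊞[] (⊝ (a ⊛ ((1# ⊖ c) ⊛ T′ c))) ∙[] σ-T-recurrence (⊛₀≡0 q (xs₀≡0 j)) (σ-xs⊛q j)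
    ⊞[] (⊝ ((1# ⊖ x) ⊛ ((1# ⊖ c) ⊛ ((1# ⊖ c) ⊛ S₁)))) ∙[] T-recurrence N (xs₀≡0 j)
    ⊞[] (⊝ ((1# ⊖ x) ⊛ ((1# ⊖ c) ⊛ ((1# ⊖ c) ⊛ T′ x)))) ∙[] σ-T-recurrence (xs₀≡0 j) (σ-xs j)
    ⊞[] (a ⊛ ((1# ⊖ c) ⊛ (1# ⊖ c))) ∙[] T-product j
    ⊞[] (a ⊛ ((1# ⊖ c) ⊛ v)) ∙[] V-T-recurrence (ys₀≡0 j) (V-ys j)
    ⊞[] (a ⊛ ((1# ⊕ c) ⊛ v′)) ∙[] V-T-recurrence (ys₀≡0 j) (V-ys j) )
    (solve 10 (λ x c t t₁ t₂ s s₁ s₂ v v′ →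
      let a = con 1ℤ :- x :* x
          p = con 1ℤ :+ c
          m = con 1ℤ :- c in
      a :* (con 1ℤ :- :- c) :* (con 1ℤ :- :- c) :* (t₂ :* s₂) :- a :* (con 1ℤ :- :- c) :* (con 1ℤ :- :- c) :* (v′ :* v′)
      := (:- (a :* (p :* s₂))) :* (m :* t₁ :- p :* t₂)
      :+ ((:- (a :* (m :* t₁))) :* (m :* s₁ :- p :* s₂)
      :+ ((:- ((con 1ℤ :- x) :* (m :* (m :* s₁)))) :* ((con 1ℤ :- x) :* t :- (con 1ℤ :+ x) :* t₁)
      :+ ((:- ((con 1ℤ :- x) :* (m :* (m :* t)))) :* ((con 1ℤ :- :- x) :* s :- (con 1ℤ :+ :- x) :* s₁)
      :+ ((a :* (m :* m)) :* (t :* s :- v :* v)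
      :+ ((a :* (m :* v)) :* (m :* v :- p :* v′)
      :+ (a :* (p :* v′)) :* (m :* v :- p :* v′)))))))
     ≈-refl x c (T′ x) (T′ c) (T′ (xs (suc j))) (σ (T′ x)) S₁ S₂ v v′))
    where
    x = xs j
    c = xs j ⊛ q
    a = 1# ⊖ x ⊛ x
    S₁ = σ (T′ c)
    S₂ = σ (T′ (xs (suc j)))
    v = V (T′ (ys j))
    v′ = V (T′ (ys (suc j)))

  private
    -- The order that `E-limit` requires, U halving exponents; it is more than enough for the two
    -- limits of T.
    J = 2 * N
    N≤J = ℕ.m≤n*m N 2
    T-xs = T-limit N (xs₀≡0 J) (≈[]-weaken N≤J (xs-order J))
    T-ys = T-limit N (ys₀≡0 J) (≈[]-weaken N≤J (ys-order J))

  T≈σφ : ∀ {z} → σ (T′ z) ≈[ N ] φ → T′ z ≈[ N ] σ φ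
  T≈σφ σT≈φ = ≈[]-trans (≈⇒≈[] (≈-sym (σ-σ _))) (σ-cong[] σT≈φ)

  φ²-truncated : E′ q ⊛ V (σ φ) ≈[ N ] φ ⊛ φ
  φ²-truncated = begin
    E′ q ⊛ V (σ φ)               ≈⟨ ⊛-cong[] ≈[]-refl (V-cong[] (T≈σφ T-ys)) ⟨
    E′ q ⊛ V (T′ (ys J))         ≈⟨ E-product J ⟨
    E′ (ss J) ⊛ σ (T′ (xs J))    ≈⟨ ⊛-cong[] (E-limit N (ss₀≡0 J) (ss-order J)) T-xs ⟩
    φ ⊛ φ                        ∎
    where open ≈[]-Reasoning N

  φσφ-truncated : φ ⊛ σ φ ≈[ N ] V (σ φ) ⊛ V (σ φ)
  φσφ-truncated = begin
    φ ⊛ σ φ                        ≈⟨ ≈⇒≈[] (⊛-comm φ (σ φ)) ⟩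
    σ φ ⊛ φ                        ≈⟨ ⊛-cong[] (T≈σφ T-xs) T-xs ⟨
    T′ (xs J) ⊛ σ (T′ (xs J))      ≈⟨ T-product J ⟩
    V (T′ (ys J)) ⊛ V (T′ (ys J))  ≈⟨ ⊛-cong[] (V-cong[] (T≈σφ T-ys)) (V-cong[] (T≈σφ T-ys)) ⟩
    V (σ φ) ⊛ V (σ φ)              ∎
    where open ≈[]-Reasoning N

F : Series
F = const (+ 2) ⊛ U v₀ ⊖ 1#

F⊛φ[-q²] : F ⊛ V (σ φ) ≈ φ ⊛ φ
F⊛φ[-q²] = ≈[]⇒≈ λ N → ≈[]-trans
  (⊛-cong[] (⊕-cong[] (⊛-cong[] ≈[]-refl (U-cong[] (≈[]-weaken (ℕ.n≤1+n _) (v₀≈∑<-term (suc (2 * N)))))) ≈[]-refl) ≈[]-refl)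
  (φ²-truncated N)

φ⊛φ[-q] : φ ⊛ σ φ ≈ V (σ φ) ⊛ V (σ φ)
φ⊛φ[-q] = ≈[]⇒≈ φσφ-truncated

-- Theta function identities

x y x₁ ψ₂ : Series
x  = φ
y  = σ φ
x₁ = V φ
ψ₂ = V (V ψ)

-- The even part of `φ⊛φ[-q]`: its right-hand side is a series in q², and its left-hand side is
-- evaluated by the dissection of φ. Then q ↦ -q gives `φ²`.
σφ² : y ⊛ y ≈ x₁ ⊛ x₁ ⊖ const (+ 4) ⊛ (q ⊛ (ψ₂ ⊛ ψ₂))
σφ² = begin
  y ⊛ y                                      ≈⟨ ≈-trans (U-cong (≈-sym (V-⊛ y y))) (U-V (y ⊛ y)) ⟨
  U (V y ⊛ V y)                              ≈⟨ U-cong φ⊛φ[-q] ⟨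
  U (x ⊛ y)                                  ≈⟨ U-⊛ x y ⟩
  U x ⊛ U y ⊕ q ⊛ (O x ⊛ O y)                ≈⟨ ⊕-cong (⊛-cong U-φ (≈-trans (U-σ φ) U-φ))
                                                  (⊛-congˡ (⊛-cong O-φ (≈-trans (O-σ φ) (⊝-cong O-φ)))) ⟩
  x₁ ⊛ x₁ ⊕ q ⊛ ((const (+ 2) ⊛ ψ₂) ⊛ (⊝ (const (+ 2) ⊛ ψ₂)))
    ≈⟨ solve 3 (λ a q p → a :* a :+ q :* ((con (+ 2) :* p) :* (:- (con (+ 2) :* p)))
         := a :* a :- con (+ 4) :* (q :* (p :* p))) ≈-refl x₁ q ψ₂ ⟩
  x₁ ⊛ x₁ ⊖ const (+ 4) ⊛ (q ⊛ (ψ₂ ⊛ ψ₂))    ∎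
  where open ≈-Reasoning

φ² : x ⊛ x ≈ x₁ ⊛ x₁ ⊕ const (+ 4) ⊛ (q ⊛ (ψ₂ ⊛ ψ₂))
φ² = begin
  x ⊛ x                                              ≈⟨ ⊛-cong (σ-σ φ) (σ-σ φ) ⟨
  σ y ⊛ σ y                                          ≈⟨ σ-⊛ y y ⟨
  σ (y ⊛ y)                                          ≈⟨ ≈-trans (σ-cong σφ²) (≈-trans (σ-⊕ _ _) (⊕-congˡ (σ-⊝ _))) ⟩
  σ (x₁ ⊛ x₁) ⊖ σ (const (+ 4) ⊛ (q ⊛ (ψ₂ ⊛ ψ₂)))    ≈⟨ ⊕-cong (≈-trans (σ-⊛ x₁ x₁) (⊛-cong (σ-V φ) (σ-V φ)))
       (⊝-cong (≈-trans (σ-⊛ _ _) (⊛-cong (σ-const (+ 4)) (≈-trans (σ-⊛ q _) (⊛-cong σ-q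
         (≈-trans (σ-⊛ ψ₂ ψ₂) (⊛-cong (σ-V _) (σ-V _)))))))) ⟩
  x₁ ⊛ x₁ ⊖ const (+ 4) ⊛ ((⊝ q) ⊛ (ψ₂ ⊛ ψ₂))
    ≈⟨ solve 3 (λ a q p → a :* a :- con (+ 4) :* (:- q :* (p :* p)) := a :* a :+ con (+ 4) :* (q :* (p :* p))) ≈-refl x₁ q ψ₂ ⟩
  x₁ ⊛ x₁ ⊕ const (+ 4) ⊛ (q ⊛ (ψ₂ ⊛ ψ₂))            ∎
  where open ≈-Reasoning

U-φ² : U (x ⊛ x) ≈ x ⊛ x
U-φ² = begin
  U (x ⊛ x)                      ≈⟨ U-⊛ x x ⟩
  U x ⊛ U x ⊕ q ⊛ (O x ⊛ O x)    ≈⟨ ⊕-cong (⊛-cong U-φ U-φ) (⊛-congˡ (⊛-cong O-φ O-φ)) ⟩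
  x₁ ⊛ x₁ ⊕ q ⊛ ((const (+ 2) ⊛ ψ₂) ⊛ (const (+ 2) ⊛ ψ₂))
    ≈⟨ solve 3 (λ a q p → a :* a :+ q :* ((con (+ 2) :* p) :* (con (+ 2) :* p)) := a :* a :+ con (+ 4) :* (q :* (p :* p))) ≈-refl x₁ q ψ₂ ⟩
  x₁ ⊛ x₁ ⊕ const (+ 4) ⊛ (q ⊛ (ψ₂ ⊛ ψ₂)) ≈⟨ φ² ⟨
  x ⊛ x                          ∎
  where open ≈-Reasoning

O-φ² : O (x ⊛ x) ≈ const (+ 4) ⊛ (x₁ ⊛ ψ₂)
O-φ² = begin
  O (x ⊛ x)              ≈⟨ O-⊛ x x ⟩
  U x ⊛ O x ⊕ O x ⊛ U x  ≈⟨ ⊕-cong (⊛-cong U-φ O-φ) (⊛-cong O-φ U-φ) ⟩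
  x₁ ⊛ (const (+ 2) ⊛ ψ₂) ⊕ (const (+ 2) ⊛ ψ₂) ⊛ x₁
    ≈⟨ solve 2 (λ a p → a :* (con (+ 2) :* p) :+ (con (+ 2) :* p) :* a := con (+ 4) :* (a :* p)) ≈-refl x₁ ψ₂ ⟩
  const (+ 4) ⊛ (x₁ ⊛ ψ₂) ∎
  where open ≈-Reasoning

opaque
  unfolding _⊕_

  const⊛-coeff : ∀ c f n → (const c ⊛ f) n ≡ c ℤ.* f n
  const⊛-coeff = const-⊛

φ₀≡1 : φ 0 ≡ 1ℤ
φ₀≡1 = trans (⊖-coeff0 (const (+ 2) ⊛ χ) 1#) (cong₂ ℤ._-_
  (trans (⊛-coeff0 _ χ) (cong₂ ℤ._*_ (const-coeff0 (+ 2)) (χ-square 0 refl))) (const-coeff0 1ℤ))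

opaque
  unfolding U

  σ-coeff0 : ∀ f → σ f 0 ≡ f 0
  σ-coeff0 f = refl

-- The inverse of φ(-q), and the series R, S and G

j : Series
j = y D.⁻¹

y⊛j : y ⊛ j ≈ 1#
y⊛j = ⁻¹-inverse y (trans (σ-coeff0 φ) φ₀≡1)

Vy⊛Vj : V y ⊛ V j ≈ 1#
Vy⊛Vj = ≈-trans (≈-sym (V-⊛ y j)) (≈-trans (V-cong y⊛j) (V-const 1ℤ))

-- Since φ(q) φ(−q) = φ(−q²)², powers of 1/φ(−q) are even up to powers of φ(q).
j≈ : j ≈ x ⊛ (V j ⊛ V j)
j≈ = combine
  ( (⊝ (j ⊛ (V y ⊛ V j ⊕ 1#))) ∙ Vy⊛Vj
  ⊞ (⊝ (j ⊛ (V j ⊛ V j))) ∙ φ⊛φ[-q]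
  ⊞ (x ⊛ (V j ⊛ V j)) ∙ y⊛j )
  (solve 5 (λ x y j z w → j :- x :* (w :* w)
    := (:- (j :* (z :* w :+ con 1ℤ))) :* (z :* w :- con 1ℤ)
    :+ ((:- (j :* (w :* w))) :* (x :* y :- z :* z)
    :+ (x :* (w :* w)) :* (y :* j :- con 1ℤ)))
   ≈-refl x y j (V y) (V j))

V-square : ∀ f → V f ⊛ V f ≈ V (f ⊛ f)
V-square f = ≈-sym (V-⊛ f f)

-- R = φ(q)²/φ(−q)² − 1 and S = φ(q)⁴/φ(−q)⁴ − 1.  U maps φ(q) ℤ[S] into
-- φ(q²) ℤ[R] and ℤ[R] into ℤ[S]; the odd parts involve the extra factor G,
-- whose square lies in q⁻¹ ℤ[S].
opaque
  β R S c G : Series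
  β = q ⊛ (ψ₂ ⊛ ψ₂) ⊛ (j ⊛ j)
  R = const (+ 8) ⊛ β
  S = R ⊛ (R ⊕ const (+ 2))
  c = const (+ 4) ⊛ (x₁ ⊛ ψ₂ ⊛ (j ⊛ j))
  G = (1# ⊕ R) ⊛ c

  -- The difference of `φ²` and `σφ²` is φ(q)² - φ(-q)² = 8q ψ(q⁴)²: the source of the 8 in R, and
  -- so of the 16 in S.
  1+R : 1# ⊕ R ≈ x ⊛ x ⊛ (j ⊛ j)
  1+R = combine
    ((⊝ (j ⊛ j)) ∙ φ² ⊞ (j ⊛ j) ∙ σφ² ⊞ (⊝ (y ⊛ j ⊕ 1#)) ∙ y⊛j)
    (solve 6 (λ x y a q p j →
      con 1ℤ :+ con (+ 8) :* (q :* (p :* p) :* (j :* j)) :- x :* x :* (j :* j)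
      := (:- (j :* j)) :* (x :* x :- (a :* a :+ con (+ 4) :* (q :* (p :* p))))
      :+ ((j :* j) :* (y :* y :- (a :* a :- con (+ 4) :* (q :* (p :* p))))
      :+ (:- (y :* j :+ con 1ℤ)) :* (y :* j :- con 1ℤ)))
     ≈-refl x y x₁ q ψ₂ j)

  x₁²j² : x₁ ⊛ x₁ ⊛ (j ⊛ j) ≈ 1# ⊕ const (+ 4) ⊛ β
  x₁²j² = combine
    ((⊝ (j ⊛ j)) ∙ σφ² ⊞ (y ⊛ j ⊕ 1#) ∙ y⊛j)
    (solve 5 (λ y a q p j →
      a :* a :* (j :* j) :- (con 1ℤ :+ con (+ 4) :* (q :* (p :* p) :* (j :* j)))
      := (:- (j :* j)) :* (y :* y :- (a :* a :- con (+ 4) :* (q :* (p :* p))))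
      :+ (y :* j :+ con 1ℤ) :* (y :* j :- con 1ℤ))
     ≈-refl y x₁ q ψ₂ j)

  q⊛c² : q ⊛ (c ⊛ c) ≈ S
  q⊛c² = combine ((const (+ 16) ⊛ β) ∙ x₁²j²)
    (solve 4 (λ a q p j → let b = q :* (p :* p) :* (j :* j) ; c = con (+ 4) :* (a :* p :* (j :* j)) in
      q :* (c :* c) :- con (+ 8) :* b :* (con (+ 8) :* b :+ con (+ 2))
      := (con (+ 16) :* b) :* (a :* a :* (j :* j) :- (con 1ℤ :+ con (+ 4) :* b)))
     ≈-refl x₁ q ψ₂ j)

  q⊛G² : q ⊛ (G ⊛ G) ≈ S ⊛ (1# ⊕ S)
  q⊛G² = combine (((1# ⊕ R) ⊛ (1# ⊕ R)) ∙ q⊛c²)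
    (solve 3 (λ q r c → let s = r :* (r :+ con (+ 2)) in
      q :* ((con 1ℤ :+ r) :* c :* ((con 1ℤ :+ r) :* c)) :- s :* (con 1ℤ :+ s)
      := ((con 1ℤ :+ r) :* (con 1ℤ :+ r)) :* (q :* (c :* c) :- s))
     ≈-refl q R c)

  -- The product of odd parts in U of φ(q) ℤ[S]: O φ contributes ψ(q⁴), and ℤ[S] contributes G. It
  -- lands in φ(q²) ℤ[R].
  q⊛ψ₂⊛G : const (+ 8) ⊛ (q ⊛ ψ₂ ⊛ G) ≈ const (+ 4) ⊛ (x₁ ⊛ R ⊛ (1# ⊕ R))
  q⊛ψ₂⊛G = solve 4 (λ a q p j → let r = con (+ 8) :* (q :* (p :* p) :* (j :* j)) in
      con (+ 8) :* (q :* p :* ((con 1ℤ :+ r) :* (con (+ 4) :* (a :* p :* (j :* j)))))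
      := con (+ 4) :* (a :* r :* (con 1ℤ :+ r))) ≈-refl x₁ q ψ₂ j

  -- The counterpart for O: φ(q²) from U φ meets G, and the result lies in ψ(q⁴) ℤ[R], with a factor
  -- 2.
  x₁⊛G : x₁ ⊛ G ≈ const (+ 2) ⊛ (ψ₂ ⊛ ((R ⊕ const (+ 2)) ⊛ (R ⊕ 1#)))
  x₁⊛G = combine ((const (+ 4) ⊛ ((1# ⊕ R) ⊛ ψ₂)) ∙ x₁²j²)
    (solve 4 (λ a b p j → let r = con (+ 8) :* b in
      a :* ((con 1ℤ :+ r) :* (con (+ 4) :* (a :* p :* (j :* j)))) :- con (+ 2) :* (p :* ((r :+ con (+ 2)) :* (r :+ con 1ℤ)))
      := (con (+ 4) :* ((con 1ℤ :+ r) :* p)) :* (a :* a :* (j :* j) :- (con 1ℤ :+ con (+ 4) :* b)))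
     ≈-refl x₁ β ψ₂ j)

  -- By `j≈` the denominator becomes a series in q², after which U and O act on φ(q)⁴ alone.
  1+R≈V : 1# ⊕ R ≈ V (j ⊛ j ⊛ (j ⊛ j)) ⊛ (x ⊛ x ⊛ (x ⊛ x))
  1+R≈V = begin
    1# ⊕ R                                           ≈⟨ 1+R ⟩
    x ⊛ x ⊛ (j ⊛ j)                                  ≈⟨ ⊛-congˡ (⊛-cong j≈ j≈) ⟩
    x ⊛ x ⊛ (x ⊛ (V j ⊛ V j) ⊛ (x ⊛ (V j ⊛ V j)))    ≈⟨ solve 2 (λ x w → x :* x :* (x :* (w :* w) :* (x :* (w :* w))) := w :* w :* (w :* w) :* (x :* x :* (x :* x))) ≈-refl x (V j) ⟩
    V j ⊛ V j ⊛ (V j ⊛ V j) ⊛ (x ⊛ x ⊛ (x ⊛ x))      ≈⟨ ⊛-congʳ (≈-trans (⊛-cong (V-square j) (V-square j)) (V-square (j ⊛ j))) ⟩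
    V (j ⊛ j ⊛ (j ⊛ j)) ⊛ (x ⊛ x ⊛ (x ⊛ x))          ∎
    where open ≈-Reasoning

  -- The even part of φ(q)⁴ has two terms. Divided by φ(-q)⁴ they are (1 + R)² = 1 + S and q c² = S.
  U-R : U R ≈ const (+ 2) ⊛ S
  U-R = combine
    ( 1# ∙ U-1+R ⊞ (⊝ (x ⊛ x ⊛ (j ⊛ j) ⊕ (1# ⊕ R))) ∙ 1+R ⊞ 1# ∙ q⊛c² )
    (solve 7 (λ u a q p j x r → let c = con (+ 4) :* (a :* p :* (j :* j)) ; s = r :* (r :+ con (+ 2)) in
      u :- con (+ 2) :* s
      := con 1ℤ :* (con 1ℤ :+ u :- j :* j :* (j :* j) :* (x :* x :* (x :* x) :+ q :* (con (+ 4) :* (a :* p) :* (con (+ 4) :* (a :* p)))))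
      :+ ((:- (x :* x :* (j :* j) :+ (con 1ℤ :+ r))) :* (con 1ℤ :+ r :- x :* x :* (j :* j))
      :+ con 1ℤ :* (q :* (c :* c) :- s)))
     ≈-refl (U R) x₁ q ψ₂ j x R)
    where
    open ≈-Reasoning
    U-1+R : 1# ⊕ U R ≈ j ⊛ j ⊛ (j ⊛ j) ⊛ (x ⊛ x ⊛ (x ⊛ x) ⊕ q ⊛ (const (+ 4) ⊛ (x₁ ⊛ ψ₂) ⊛ (const (+ 4) ⊛ (x₁ ⊛ ψ₂))))
    U-1+R = begin
      1# ⊕ U R                                     ≈⟨ ≈-trans (U-⊕ 1# R) (⊕-congʳ (U-const 1ℤ)) ⟨
      U (1# ⊕ R)                                   ≈⟨ U-cong 1+R≈V ⟩
      U (V (j ⊛ j ⊛ (j ⊛ j)) ⊛ (x ⊛ x ⊛ (x ⊛ x)))  ≈⟨ U-V⊛ _ _ ⟩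
      j ⊛ j ⊛ (j ⊛ j) ⊛ U (x ⊛ x ⊛ (x ⊛ x))        ≈⟨ ⊛-congˡ (≈-trans (U-⊛ _ _) (⊕-cong (⊛-cong U-φ² U-φ²) (⊛-congˡ (⊛-cong O-φ² O-φ²)))) ⟩
      _ ∎

  O-R : O R ≈ const (+ 2) ⊛ G
  O-R = combine
    ( 1# ∙ O-1+R ⊞ (⊝ (const (+ 8) ⊛ (x₁ ⊛ ψ₂ ⊛ (j ⊛ j)))) ∙ 1+R )
    (solve 6 (λ u a p j x r →
      u :- con (+ 2) :* ((con 1ℤ :+ r) :* (con (+ 4) :* (a :* p :* (j :* j))))
      := con 1ℤ :* (u :- j :* j :* (j :* j) :* (x :* x :* (con (+ 4) :* (a :* p)) :+ con (+ 4) :* (a :* p) :* (x :* x)))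
      :+ (:- (con (+ 8) :* (a :* p :* (j :* j)))) :* (con 1ℤ :+ r :- x :* x :* (j :* j)))
     ≈-refl (O R) x₁ ψ₂ j x R)
    where
    open ≈-Reasoning
    O-1+R : O R ≈ j ⊛ j ⊛ (j ⊛ j) ⊛ (x ⊛ x ⊛ (const (+ 4) ⊛ (x₁ ⊛ ψ₂)) ⊕ const (+ 4) ⊛ (x₁ ⊛ ψ₂) ⊛ (x ⊛ x))
    O-1+R = begin
      O R                                          ≈⟨ ≈-trans (O-⊕ 1# R) (≈-trans (⊕-congʳ (O-const 1ℤ)) (⊕-identityˡ _)) ⟨
      O (1# ⊕ R)                                   ≈⟨ O-cong 1+R≈V ⟩
      O (V (j ⊛ j ⊛ (j ⊛ j)) ⊛ (x ⊛ x ⊛ (x ⊛ x)))  ≈⟨ O-V⊛ _ _ ⟩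
      j ⊛ j ⊛ (j ⊛ j) ⊛ O (x ⊛ x ⊛ (x ⊛ x))        ≈⟨ ⊛-congˡ (≈-trans (O-⊛ _ _) (⊕-cong (⊛-cong U-φ² O-φ²) (⊛-cong O-φ² U-φ²))) ⟩
      _ ∎

  S≈R²+2R : S ≈ R ⊛ (R ⊕ const (+ 2))
  S≈R²+2R = ≈-refl

  S≈16 : S ≈ const (+ 16) ⊛ (β ⊕ const (+ 4) ⊛ (β ⊛ β))
  S≈16 = solve 1 (λ b → con (+ 8) :* b :* (con (+ 8) :* b :+ con (+ 2)) := con (+ 16) :* (b :+ con (+ 4) :* (b :* b))) ≈-refl β

-- The action of U ∘ U on φ(q) ℤ[S]

infixl 6 _+ₚ_
infixl 7 _*ₚ_

-- Unnormalised expressions for integer polynomials: a witness of membership in ℤ[R] or ℤ[S] is such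
-- an expression, built by induction on another.
data Poly : Set where
  conₚ      : ℤ → Poly
  X         : Poly
  _+ₚ_ _*ₚ_ : Poly → Poly → Poly

⟦_⟧ : Poly → Series → Series
⟦ conₚ a ⟧ f = const a
⟦ X ⟧ f = f
⟦ p +ₚ p′ ⟧ f = ⟦ p ⟧ f ⊕ ⟦ p′ ⟧ f
⟦ p *ₚ p′ ⟧ f = ⟦ p ⟧ f ⊛ ⟦ p′ ⟧ f

S-in-R : Poly → Poly
S-in-R (conₚ a) = conₚ a
S-in-R X = X *ₚ (X +ₚ conₚ (+ 2))
S-in-R (p +ₚ p′) = S-in-R p +ₚ S-in-R p′
S-in-R (p *ₚ p′) = S-in-R p *ₚ S-in-R p′

⟦S-in-R⟧ : ∀ p → ⟦ S-in-R p ⟧ R ≈ ⟦ p ⟧ S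
⟦S-in-R⟧ (conₚ a) = ≈-refl
⟦S-in-R⟧ X = ≈-sym S≈R²+2R
⟦S-in-R⟧ (p +ₚ p′) = ⊕-cong (⟦S-in-R⟧ p) (⟦S-in-R⟧ p′)
⟦S-in-R⟧ (p *ₚ p′) = ⊛-cong (⟦S-in-R⟧ p) (⟦S-in-R⟧ p′)

-- This and the next lemmas are opaque so that `with` does not normalise their proofs.
opaque
  UO-ℤ[R] : ∀ p → ∃[ a ] ∃[ h ] ∃[ k ]
    (U (⟦ p ⟧ R) ≈ const a ⊕ const (+ 2) ⊛ (S ⊛ ⟦ h ⟧ S)) × (O (⟦ p ⟧ R) ≈ const (+ 2) ⊛ (G ⊛ ⟦ k ⟧ S))
  UO-ℤ[R] (conₚ a) = a , conₚ 0ℤ , conₚ 0ℤ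
    , ≈-trans (U-const a) (solve 2 (λ a s → a := a :+ con (+ 2) :* (s :* con 0ℤ)) ≈-refl (const a) S)
    , ≈-trans (O-const a) (≈-trans (≈-sym const-0) (solve 1 (λ g → con 0ℤ := con (+ 2) :* (g :* con 0ℤ)) ≈-refl G))
  UO-ℤ[R] X = 0ℤ , conₚ 1ℤ , conₚ 1ℤ
    , ≈-trans U-R (solve 1 (λ s → con (+ 2) :* s := con 0ℤ :+ con (+ 2) :* (s :* con 1ℤ)) ≈-refl S)
    , ≈-trans O-R (solve 1 (λ g → con (+ 2) :* g := con (+ 2) :* (g :* con 1ℤ)) ≈-refl G)
  UO-ℤ[R] (p +ₚ p′) with UO-ℤ[R] p | UO-ℤ[R] p′
  ... | a , h , k , u , o | a′ , h′ , k′ , u′ , o′ = a ℤ.+ a′ , h +ₚ h′ , k +ₚ k′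
    , ≈-trans (U-⊕ _ _) (≈-trans (⊕-cong u u′) (≈-trans
        (solve 5 (λ a a′ s h h′ → (a :+ con (+ 2) :* (s :* h)) :+ (a′ :+ con (+ 2) :* (s :* h′))
          := a :+ a′ :+ con (+ 2) :* (s :* (h :+ h′))) ≈-refl (const a) (const a′) S (⟦ h ⟧ S) (⟦ h′ ⟧ S))
        (⊕-congʳ (≈-sym (const-⊕ a a′)))))
    , ≈-trans (O-⊕ _ _) (≈-trans (⊕-cong o o′)
        (solve 3 (λ g k k′ → con (+ 2) :* (g :* k) :+ con (+ 2) :* (g :* k′) := con (+ 2) :* (g :* (k :+ k′)))
          ≈-refl G (⟦ k ⟧ S) (⟦ k′ ⟧ S)))
  UO-ℤ[R] (p *ₚ p′) with UO-ℤ[R] p | UO-ℤ[R] p′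
  ... | a , h , k , u , o | a′ , h′ , k′ , u′ , o′ = a ℤ.* a′
    , conₚ a *ₚ h′ +ₚ conₚ a′ *ₚ h +ₚ conₚ (+ 2) *ₚ X *ₚ h *ₚ h′ +ₚ conₚ (+ 2) *ₚ (conₚ 1ℤ +ₚ X) *ₚ k *ₚ k′
    , (conₚ a +ₚ conₚ (+ 2) *ₚ (X *ₚ h)) *ₚ k′ +ₚ k *ₚ (conₚ a′ +ₚ conₚ (+ 2) *ₚ (X *ₚ h′))
    -- The odd parts multiply to 4 q G² k k′, and q G² = S (1 + S) returns this to 2 S ℤ[S].
    , ≈-trans (U-⊛ _ _) (≈-trans (⊕-cong (⊛-cong u u′) (⊛-congˡ (⊛-cong o o′)))
        (combine ((const (+ 4) ⊛ (⟦ k ⟧ S ⊛ ⟦ k′ ⟧ S)) ∙ q⊛G² ⊞ (⊝ 1#) ∙ const-* a a′)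
          (solve 10 (λ a a′ aa s h h′ g k k′ q →
            (a :+ con (+ 2) :* (s :* h)) :* (a′ :+ con (+ 2) :* (s :* h′)) :+ q :* (con (+ 2) :* (g :* k) :* (con (+ 2) :* (g :* k′)))
              :- (aa :+ con (+ 2) :* (s :* (a :* h′ :+ a′ :* h :+ con (+ 2) :* s :* h :* h′ :+ con (+ 2) :* (con 1ℤ :+ s) :* k :* k′)))
            := (con (+ 4) :* (k :* k′)) :* (q :* (g :* g) :- s :* (con 1ℤ :+ s)) :+ (:- con 1ℤ) :* (aa :- a :* a′))
           ≈-refl (const a) (const a′) (const (a ℤ.* a′)) S (⟦ h ⟧ S) (⟦ h′ ⟧ S) G (⟦ k ⟧ S) (⟦ k′ ⟧ S) q)))
    , ≈-trans (O-⊛ _ _) (≈-trans (⊕-cong (⊛-cong u o′) (⊛-cong o u′))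
        (solve 8 (λ a a′ s h h′ g k k′ →
          (a :+ con (+ 2) :* (s :* h)) :* (con (+ 2) :* (g :* k′)) :+ con (+ 2) :* (g :* k) :* (a′ :+ con (+ 2) :* (s :* h′))
          := con (+ 2) :* (g :* ((a :+ con (+ 2) :* (s :* h)) :* k′ :+ k :* (a′ :+ con (+ 2) :* (s :* h′)))))
         ≈-refl (const a) (const a′) S (⟦ h ⟧ S) (⟦ h′ ⟧ S) G (⟦ k ⟧ S) (⟦ k′ ⟧ S)))

-- Both contributions, 2S (2S + 2) from the even parts and q (2G)² from the odd ones, equal 4 S (1 +
-- S).
U-S : U S ≈ const (+ 8) ⊛ (S ⊛ (1# ⊕ S))
U-S = begin
  U S                         ≈⟨ ≈-trans (U-cong S≈R²+2R) (U-⊛ _ _) ⟩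
  U R ⊛ U (R ⊕ const (+ 2)) ⊕ q ⊛ (O R ⊛ O (R ⊕ const (+ 2)))
    ≈⟨ ⊕-cong (⊛-cong U-R (≈-trans (U-⊕ _ _) (⊕-cong U-R (U-const (+ 2)))))
         (⊛-congˡ (⊛-cong O-R (≈-trans (O-⊕ _ _) (≈-trans (⊕-cong O-R (O-const (+ 2))) (⊕-identityʳ _))))) ⟩
  const (+ 2) ⊛ S ⊛ (const (+ 2) ⊛ S ⊕ const (+ 2)) ⊕ q ⊛ (const (+ 2) ⊛ G ⊛ (const (+ 2) ⊛ G))
    ≈⟨ combine (const (+ 4) ∙ q⊛G²)
        (solve 3 (λ s q g → con (+ 2) :* s :* (con (+ 2) :* s :+ con (+ 2)) :+ q :* (con (+ 2) :* g :* (con (+ 2) :* g))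
          :- con (+ 8) :* (s :* (con 1ℤ :+ s)) := con (+ 4) :* (q :* (g :* g) :- s :* (con 1ℤ :+ s))) ≈-refl S q G) ⟩
  const (+ 8) ⊛ (S ⊛ (1# ⊕ S)) ∎
  where open ≈-Reasoning

O-S : O S ≈ const (+ 4) ⊛ (G ⊛ (1# ⊕ const (+ 2) ⊛ S))
O-S = begin
  O S                         ≈⟨ ≈-trans (O-cong S≈R²+2R) (O-⊛ _ _) ⟩
  U R ⊛ O (R ⊕ const (+ 2)) ⊕ O R ⊛ U (R ⊕ const (+ 2))
    ≈⟨ ⊕-cong (⊛-cong U-R (≈-trans (O-⊕ _ _) (≈-trans (⊕-cong O-R (O-const (+ 2))) (⊕-identityʳ _))))
         (⊛-cong O-R (≈-trans (U-⊕ _ _) (⊕-cong U-R (U-const (+ 2))))) ⟩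
  const (+ 2) ⊛ S ⊛ (const (+ 2) ⊛ G) ⊕ const (+ 2) ⊛ G ⊛ (const (+ 2) ⊛ S ⊕ const (+ 2))
    ≈⟨ solve 2 (λ s g → con (+ 2) :* s :* (con (+ 2) :* g) :+ con (+ 2) :* g :* (con (+ 2) :* s :+ con (+ 2))
         := con (+ 4) :* (g :* (con 1ℤ :+ con (+ 2) :* s))) ≈-refl S G ⟩
  const (+ 4) ⊛ (G ⊛ (1# ⊕ const (+ 2) ⊛ S)) ∎
  where open ≈-Reasoning

opaque
  UO-ℤ[S] : ∀ p → ∃[ h ] ∃[ k ] (U (⟦ p ⟧ S) ≈ ⟦ h ⟧ S) × (O (⟦ p ⟧ S) ≈ const (+ 4) ⊛ (G ⊛ ⟦ k ⟧ S))
  UO-ℤ[S] (conₚ a) = conₚ a , conₚ 0ℤ , U-const a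
    , ≈-trans (O-const a) (≈-trans (≈-sym const-0) (solve 1 (λ g → con 0ℤ := con (+ 4) :* (g :* con 0ℤ)) ≈-refl G))
  UO-ℤ[S] X = conₚ (+ 8) *ₚ (X *ₚ (conₚ 1ℤ +ₚ X)) , conₚ 1ℤ +ₚ conₚ (+ 2) *ₚ X , U-S , O-S
  UO-ℤ[S] (p +ₚ p′) with UO-ℤ[S] p | UO-ℤ[S] p′
  ... | h , k , u , o | h′ , k′ , u′ , o′ = h +ₚ h′ , k +ₚ k′
    , ≈-trans (U-⊕ _ _) (⊕-cong u u′)
    , ≈-trans (O-⊕ _ _) (≈-trans (⊕-cong o o′)
        (solve 3 (λ g k k′ → con (+ 4) :* (g :* k) :+ con (+ 4) :* (g :* k′) := con (+ 4) :* (g :* (k :+ k′)))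
          ≈-refl G (⟦ k ⟧ S) (⟦ k′ ⟧ S)))
  UO-ℤ[S] (p *ₚ p′) with UO-ℤ[S] p | UO-ℤ[S] p′
  ... | h , k , u , o | h′ , k′ , u′ , o′
    = h *ₚ h′ +ₚ conₚ (+ 16) *ₚ (X *ₚ (conₚ 1ℤ +ₚ X)) *ₚ k *ₚ k′
    , h *ₚ k′ +ₚ k *ₚ h′
    , ≈-trans (U-⊛ _ _) (≈-trans (⊕-cong (⊛-cong u u′) (⊛-congˡ (⊛-cong o o′)))
        (combine ((const (+ 16) ⊛ (⟦ k ⟧ S ⊛ ⟦ k′ ⟧ S)) ∙ q⊛G²)
          (solve 7 (λ s h h′ g k k′ q →
            h :* h′ :+ q :* (con (+ 4) :* (g :* k) :* (con (+ 4) :* (g :* k′)))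
              :- (h :* h′ :+ con (+ 16) :* (s :* (con 1ℤ :+ s)) :* k :* k′)
            := (con (+ 16) :* (k :* k′)) :* (q :* (g :* g) :- s :* (con 1ℤ :+ s)))
           ≈-refl S (⟦ h ⟧ S) (⟦ h′ ⟧ S) G (⟦ k ⟧ S) (⟦ k′ ⟧ S) q)))
    , ≈-trans (O-⊛ _ _) (≈-trans (⊕-cong (⊛-cong u o′) (⊛-cong o u′))
        (solve 5 (λ h h′ g k k′ → h :* (con (+ 4) :* (g :* k′)) :+ con (+ 4) :* (g :* k) :* h′
          := con (+ 4) :* (g :* (h :* k′ :+ k :* h′))) ≈-refl (⟦ h ⟧ S) (⟦ h′ ⟧ S) G (⟦ k ⟧ S) (⟦ k′ ⟧ S)))

opaque
  -- In U the even parts contribute 8 S from `U-S`, the odd parts 16 q G² = 16 S (1 + S): a factor 8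
  -- S in either case.
  UO-Sℤ[S] : ∀ p → ∃[ h ] ∃[ k ]
    (U (S ⊛ ⟦ p ⟧ S) ≈ const (+ 8) ⊛ (S ⊛ ⟦ h ⟧ S)) × (O (S ⊛ ⟦ p ⟧ S) ≈ const (+ 4) ⊛ (G ⊛ ⟦ k ⟧ S))
  UO-Sℤ[S] p with UO-ℤ[S] p
  ... | h , k , u , o
    = (conₚ 1ℤ +ₚ X) *ₚ (h +ₚ conₚ (+ 2) *ₚ (conₚ 1ℤ +ₚ conₚ (+ 2) *ₚ X) *ₚ k)
    , conₚ (+ 8) *ₚ (X *ₚ (conₚ 1ℤ +ₚ X)) *ₚ k +ₚ (conₚ 1ℤ +ₚ conₚ (+ 2) *ₚ X) *ₚ h
    , ≈-trans (U-⊛ _ _) (≈-trans (⊕-cong (⊛-cong U-S u) (⊛-congˡ (⊛-cong O-S o)))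
        (combine ((const (+ 16) ⊛ ((1# ⊕ const (+ 2) ⊛ S) ⊛ ⟦ k ⟧ S)) ∙ q⊛G²)
          (solve 5 (λ s h g k q →
            con (+ 8) :* (s :* (con 1ℤ :+ s)) :* h :+ q :* (con (+ 4) :* (g :* (con 1ℤ :+ con (+ 2) :* s)) :* (con (+ 4) :* (g :* k)))
              :- con (+ 8) :* (s :* ((con 1ℤ :+ s) :* (h :+ con (+ 2) :* (con 1ℤ :+ con (+ 2) :* s) :* k)))
            := (con (+ 16) :* ((con 1ℤ :+ con (+ 2) :* s) :* k)) :* (q :* (g :* g) :- s :* (con 1ℤ :+ s)))
           ≈-refl S (⟦ h ⟧ S) G (⟦ k ⟧ S) q)))
    , ≈-trans (O-⊛ _ _) (≈-trans (⊕-cong (⊛-cong U-S o) (⊛-cong O-S u))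
        (solve 4 (λ s h g k →
          con (+ 8) :* (s :* (con 1ℤ :+ s)) :* (con (+ 4) :* (g :* k)) :+ con (+ 4) :* (g :* (con 1ℤ :+ con (+ 2) :* s)) :* h
          := con (+ 4) :* (g :* (con (+ 8) :* (s :* (con 1ℤ :+ s)) :* k :+ (con 1ℤ :+ con (+ 2) :* s) :* h)))
         ≈-refl S (⟦ h ⟧ S) G (⟦ k ⟧ S)))

opaque
  U-Rℤ[R] : ∀ p → ∃[ h ] U (R ⊛ ⟦ p ⟧ R) ≈ const (+ 2) ⊛ (S ⊛ ⟦ h ⟧ S)
  U-Rℤ[R] p with UO-ℤ[R] p
  ... | a , h , k , u , o
    = conₚ a +ₚ conₚ (+ 2) *ₚ (X *ₚ h) +ₚ conₚ (+ 2) *ₚ (conₚ 1ℤ +ₚ X) *ₚ k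
    , ≈-trans (U-⊛ _ _) (≈-trans (⊕-cong (⊛-cong U-R u) (⊛-congˡ (⊛-cong O-R o)))
        (combine ((const (+ 4) ⊛ ⟦ k ⟧ S) ∙ q⊛G²)
          (solve 6 (λ a s h g k q →
            con (+ 2) :* s :* (a :+ con (+ 2) :* (s :* h)) :+ q :* (con (+ 2) :* g :* (con (+ 2) :* (g :* k)))
              :- con (+ 2) :* (s :* (a :+ con (+ 2) :* (s :* h) :+ con (+ 2) :* (con 1ℤ :+ s) :* k))
            := (con (+ 4) :* k) :* (q :* (g :* g) :- s :* (con 1ℤ :+ s)))
           ≈-refl (const a) S (⟦ h ⟧ S) G (⟦ k ⟧ S) q)))

opaque
  -- Since U φ = φ(q²), one application leads from φ(q) ℤ[S] to φ(q²) ℤ[R], with a factor 4. In the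
  -- second, φ(q²) passes through U as an even factor and `U-Rℤ[R]` leads back to ℤ[S], with a
  -- factor 2.
  U-φSℤ[S] : ∀ p → ∃[ m ] U (φ ⊛ (S ⊛ ⟦ p ⟧ S)) ≈ const (+ 4) ⊛ (V φ ⊛ (R ⊛ ⟦ m ⟧ R))
  U-φSℤ[S] p with UO-Sℤ[S] p
  ... | h , k , u , o = m , (begin
    U (φ ⊛ (S ⊛ ⟦ p ⟧ S))
      ≈⟨ U-⊛ φ _ ⟩
    U φ ⊛ U (S ⊛ ⟦ p ⟧ S) ⊕ q ⊛ (O φ ⊛ O (S ⊛ ⟦ p ⟧ S))
      ≈⟨ ⊕-cong (⊛-cong U-φ u) (⊛-congˡ (⊛-cong O-φ o)) ⟩
    x₁ ⊛ (const (+ 8) ⊛ (S ⊛ ⟦ h ⟧ S)) ⊕ q ⊛ (const (+ 2) ⊛ ψ₂ ⊛ (const (+ 4) ⊛ (G ⊛ ⟦ k ⟧ S)))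
      ≈⟨ combine (⟦ k ⟧ S ∙ q⊛ψ₂⊛G ⊞ (const (+ 8) ⊛ (x₁ ⊛ ⟦ h ⟧ S)) ∙ S≈R²+2R)
          (solve 8 (λ a r h k q p g s →
            a :* (con (+ 8) :* (s :* h)) :+ q :* (con (+ 2) :* p :* (con (+ 4) :* (g :* k)))
              :- con (+ 4) :* (a :* (r :* (con (+ 2) :* (r :+ con (+ 2)) :* h :+ (con 1ℤ :+ r) :* k)))
            := k :* (con (+ 8) :* (q :* p :* g) :- con (+ 4) :* (a :* r :* (con 1ℤ :+ r)))
            :+ (con (+ 8) :* (a :* h)) :* (s :- r :* (r :+ con (+ 2))))
           ≈-refl x₁ R (⟦ h ⟧ S) (⟦ k ⟧ S) q ψ₂ G S) ⟩
    const (+ 4) ⊛ (V φ ⊛ (R ⊛ (const (+ 2) ⊛ (R ⊕ const (+ 2)) ⊛ ⟦ h ⟧ S ⊕ (1# ⊕ R) ⊛ ⟦ k ⟧ S)))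
      ≈⟨ ⊛-congˡ (⊛-congˡ (⊛-congˡ (⊕-cong (⊛-congˡ (⟦S-in-R⟧ h)) (⊛-congˡ (⟦S-in-R⟧ k))))) ⟨
    const (+ 4) ⊛ (V φ ⊛ (R ⊛ ⟦ m ⟧ R)) ∎)
    where
    open ≈-Reasoning
    m : Poly
    m = conₚ (+ 2) *ₚ (X +ₚ conₚ (+ 2)) *ₚ S-in-R h +ₚ (conₚ 1ℤ +ₚ X) *ₚ S-in-R k

opaque
  UU-φSℤ[S] : ∀ p → ∃[ p′ ] U (U (φ ⊛ (S ⊛ ⟦ p ⟧ S))) ≈ const (+ 8) ⊛ (φ ⊛ (S ⊛ ⟦ p′ ⟧ S))
  UU-φSℤ[S] p with U-φSℤ[S] p
  ... | m , first with U-Rℤ[R] m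
  ...   | p′ , second = p′ , (begin
    U (U (φ ⊛ (S ⊛ ⟦ p ⟧ S)))                ≈⟨ U-cong first ⟩
    U (const (+ 4) ⊛ (V φ ⊛ (R ⊛ ⟦ m ⟧ R)))  ≈⟨ ≈-trans (U-const⊛ (+ 4) _) (⊛-congˡ (≈-trans (U-V⊛ φ _) (⊛-congˡ second))) ⟩
    const (+ 4) ⊛ (φ ⊛ (const (+ 2) ⊛ (S ⊛ ⟦ p′ ⟧ S)))
      ≈⟨ solve 2 (λ x y → con (+ 4) :* (x :* (con (+ 2) :* y)) := con (+ 8) :* (x :* y)) ≈-refl φ (S ⊛ ⟦ p′ ⟧ S) ⟩
    const (+ 8) ⊛ (φ ⊛ (S ⊛ ⟦ p′ ⟧ S))       ∎)
    where open ≈-Reasoning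

opaque
  O-φSℤ[S] : ∀ p → ∃[ m ] O (φ ⊛ (S ⊛ ⟦ p ⟧ S)) ≈ const (+ 8) ⊛ (V (V ψ) ⊛ ⟦ m ⟧ R)
  O-φSℤ[S] p with UO-Sℤ[S] p
  ... | h , k , u , o = m , (begin
    O (φ ⊛ (S ⊛ ⟦ p ⟧ S))
      ≈⟨ O-⊛ φ _ ⟩
    U φ ⊛ O (S ⊛ ⟦ p ⟧ S) ⊕ O φ ⊛ U (S ⊛ ⟦ p ⟧ S)
      ≈⟨ ⊕-cong (⊛-cong U-φ o) (⊛-cong O-φ u) ⟩
    x₁ ⊛ (const (+ 4) ⊛ (G ⊛ ⟦ k ⟧ S)) ⊕ const (+ 2) ⊛ ψ₂ ⊛ (const (+ 8) ⊛ (S ⊛ ⟦ h ⟧ S))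
      ≈⟨ combine ((const (+ 4) ⊛ ⟦ k ⟧ S) ∙ x₁⊛G)
          (solve 7 (λ a r h k p g s →
            a :* (con (+ 4) :* (g :* k)) :+ con (+ 2) :* p :* (con (+ 8) :* (s :* h))
              :- con (+ 8) :* (p :* (con (+ 2) :* s :* h :+ (r :+ con (+ 2)) :* (r :+ con 1ℤ) :* k))
            := (con (+ 4) :* k) :* (a :* g :- con (+ 2) :* (p :* ((r :+ con (+ 2)) :* (r :+ con 1ℤ)))))
           ≈-refl x₁ R (⟦ h ⟧ S) (⟦ k ⟧ S) ψ₂ G S) ⟩
    const (+ 8) ⊛ (V (V ψ) ⊛ (const (+ 2) ⊛ S ⊛ ⟦ h ⟧ S ⊕ (R ⊕ const (+ 2)) ⊛ (R ⊕ 1#) ⊛ ⟦ k ⟧ S))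
      ≈⟨ ⊛-congˡ (⊛-congˡ (⊕-cong (⊛-cong (⊛-congˡ (⟦S-in-R⟧ X)) (⟦S-in-R⟧ h)) (⊛-congˡ (⟦S-in-R⟧ k)))) ⟨
    const (+ 8) ⊛ (V (V ψ) ⊛ ⟦ m ⟧ R) ∎)
    where
    open ≈-Reasoning
    m : Poly
    m = conₚ (+ 2) *ₚ S-in-R X *ₚ S-in-R h +ₚ (X +ₚ conₚ (+ 2)) *ₚ (X +ₚ conₚ 1ℤ) *ₚ S-in-R k

opaque
  U-ψ₁ℤ[S] : ∀ a p → ∃[ z ] U (V ψ ⊛ (const a ⊕ const (+ 2) ⊛ (S ⊛ ⟦ p ⟧ S))) ≈ const a ⊛ ψ ⊕ const (+ 256) ⊛ z
  U-ψ₁ℤ[S] a p with UO-Sℤ[S] p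
  ... | h , _ , u , _ = ψ ⊛ ((β ⊕ const (+ 4) ⊛ (β ⊛ β)) ⊛ ⟦ h ⟧ S) , (begin
    U (V ψ ⊛ (const a ⊕ const (+ 2) ⊛ (S ⊛ ⟦ p ⟧ S)))
      ≈⟨ ≈-trans (U-V⊛ ψ _) (⊛-congˡ (≈-trans (U-⊕ _ _) (⊕-cong (U-const a) (≈-trans (U-const⊛ (+ 2) _) (⊛-congˡ u))))) ⟩
    ψ ⊛ (const a ⊕ const (+ 2) ⊛ (const (+ 8) ⊛ (S ⊛ ⟦ h ⟧ S)))
      ≈⟨ combine ((const (+ 16) ⊛ (ψ ⊛ ⟦ h ⟧ S)) ∙ S≈16)
          (solve 5 (λ e f a s s′ →
            e :* (a :+ con (+ 2) :* (con (+ 8) :* (s :* f))) :- (a :* e :+ con (+ 256) :* (e :* (s′ :* f)))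
            := (con (+ 16) :* (e :* f)) :* (s :- con (+ 16) :* s′))
           ≈-refl ψ (⟦ h ⟧ S) (const a) S (β ⊕ const (+ 4) ⊛ (β ⊛ β))) ⟩
    const a ⊛ ψ ⊕ const (+ 256) ⊛ (ψ ⊛ ((β ⊕ const (+ 4) ⊛ (β ⊛ β)) ⊛ ⟦ h ⟧ S)) ∎)
    where open ≈-Reasoning

opaque
  UUO-φSℤ[S] : ∀ p → ∃[ a ] ∃[ z ] U (U (O (φ ⊛ (S ⊛ ⟦ p ⟧ S)))) ≈ const a ⊛ ψ ⊕ const (+ 2048) ⊛ z
  UUO-φSℤ[S] p with O-φSℤ[S] p
  ... | m , first with UO-ℤ[R] m
  ...   | a , h , _ , second , _ with U-ψ₁ℤ[S] a h
  ...     | z , third = + 8 ℤ.* a , z , (begin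
    U (U (O (φ ⊛ (S ⊛ ⟦ p ⟧ S))))              ≈⟨ U-cong (U-cong first) ⟩
    U (U (const (+ 8) ⊛ (V (V ψ) ⊛ ⟦ m ⟧ R)))  ≈⟨ U-cong (≈-trans (U-const⊛ (+ 8) _) (⊛-congˡ (≈-trans (U-V⊛ (V ψ) _) (⊛-congˡ second)))) ⟩
    U (const (+ 8) ⊛ (V ψ ⊛ (const a ⊕ const (+ 2) ⊛ (S ⊛ ⟦ h ⟧ S))))
      ≈⟨ ≈-trans (U-const⊛ (+ 8) _) (⊛-congˡ third) ⟩
    const (+ 8) ⊛ (const a ⊛ ψ ⊕ const (+ 256) ⊛ z)
      ≈⟨ combine ((⊝ ψ) ∙ const-* (+ 8) a)
          (solve 4 (λ e z a a′ → con (+ 8) :* (a :* e :+ con (+ 256) :* z) :- (a′ :* e :+ con (+ 2048) :* z)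
            := (:- e) :* (a′ :- con (+ 8) :* a)) ≈-refl ψ z (const a) (const (+ 8 ℤ.* a))) ⟩
    const (+ 8 ℤ.* a) ⊛ ψ ⊕ const (+ 2048) ⊛ z ∎)
    where open ≈-Reasoning

-- The series Σ v₀(4ᵅ⁺¹ n) qⁿ

F₀ : Series
F₀ = U F

F₀≈V : F₀ ≈ V (j ⊛ j) ⊛ (x ⊛ x ⊛ x)
F₀≈V = combine
  ( (⊝ F₀) ∙ y⊛j
  ⊞ j ∙ F₀⊛y
  ⊞ (x ⊛ x) ∙ j≈
  ⊞ (x ⊛ x ⊛ x) ∙ V-square j )
  (solve 6 (λ f y j x w v → f :- v :* (x :* x :* x)
    := (:- f) :* (y :* j :- con 1ℤ) :+ (j :* (f :* y :- x :* x)
    :+ ((x :* x) :* (j :- x :* (w :* w)) :+ (x :* x :* x) :* (w :* w :- v))))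
   ≈-refl F₀ y j x (V j) (V (j ⊛ j)))
  where
  open ≈-Reasoning
  F₀⊛y : F₀ ⊛ y ≈ x ⊛ x
  F₀⊛y = begin
    U F ⊛ y        ≈⟨ ⊛-comm (U F) y ⟩
    y ⊛ U F        ≈⟨ U-V⊛ y F ⟨
    U (V y ⊛ F)    ≈⟨ U-cong (≈-trans (⊛-comm (V y) F) F⊛φ[-q²]) ⟩
    U (x ⊛ x)      ≈⟨ U-φ² ⟩
    x ⊛ x          ∎

opaque
  unfolding S

  U-F₀ : U F₀ ≈ V φ ⊛ (1# ⊕ const (+ 2) ⊛ R)
  U-F₀ = begin
    U F₀                            ≈⟨ ≈-trans (U-cong F₀≈V) (U-V⊛ _ _) ⟩
    j ⊛ j ⊛ U (x ⊛ x ⊛ x)           ≈⟨ ⊛-congˡ (≈-trans (U-⊛ _ _) (⊕-cong (⊛-cong U-φ² U-φ) (⊛-congˡ (⊛-cong O-φ² O-φ)))) ⟩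
    j ⊛ j ⊛ (x ⊛ x ⊛ x₁ ⊕ q ⊛ (const (+ 4) ⊛ (x₁ ⊛ ψ₂) ⊛ (const (+ 2) ⊛ ψ₂)))
      ≈⟨ combine ((⊝ x₁) ∙ 1+R)
          (solve 5 (λ j x a q p → let r = con (+ 8) :* (q :* (p :* p) :* (j :* j)) in
            j :* j :* (x :* x :* a :+ q :* (con (+ 4) :* (a :* p) :* (con (+ 2) :* p))) :- a :* (con 1ℤ :+ con (+ 2) :* r)
            := (:- a) :* ((con 1ℤ :+ r) :- x :* x :* (j :* j)))
           ≈-refl j x x₁ q ψ₂) ⟩
    V φ ⊛ (1# ⊕ const (+ 2) ⊛ R)    ∎
    where open ≈-Reasoning

  O-F₀ : O F₀ ≈ const (+ 2) ⊛ (V (V ψ) ⊛ (const (+ 3) ⊕ const (+ 2) ⊛ R))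
  O-F₀ = begin
    O F₀                            ≈⟨ ≈-trans (O-cong F₀≈V) (O-V⊛ _ _) ⟩
    j ⊛ j ⊛ O (x ⊛ x ⊛ x)           ≈⟨ ⊛-congˡ (≈-trans (O-⊛ _ _) (⊕-cong (⊛-cong U-φ² O-φ) (⊛-cong O-φ² U-φ))) ⟩
    j ⊛ j ⊛ (x ⊛ x ⊛ (const (+ 2) ⊛ ψ₂) ⊕ const (+ 4) ⊛ (x₁ ⊛ ψ₂) ⊛ x₁)
      ≈⟨ combine ((⊝ (const (+ 2) ⊛ ψ₂)) ∙ 1+R ⊞ (const (+ 4) ⊛ ψ₂) ∙ x₁²j²)
          (solve 5 (λ j x a b p → let r = con (+ 8) :* b in
            j :* j :* (x :* x :* (con (+ 2) :* p) :+ con (+ 4) :* (a :* p) :* a) :- con (+ 2) :* (p :* (con (+ 3) :+ con (+ 2) :* r))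
            := (:- (con (+ 2) :* p)) :* ((con 1ℤ :+ r) :- x :* x :* (j :* j))
            :+ (con (+ 4) :* p) :* (a :* a :* (j :* j) :- (con 1ℤ :+ con (+ 4) :* b)))
           ≈-refl j x x₁ β ψ₂) ⟩
    const (+ 2) ⊛ (V (V ψ) ⊛ (const (+ 3) ⊕ const (+ 2) ⊛ R)) ∎
    where open ≈-Reasoning

U-affine : ∀ a f → U (const a ⊕ const (+ 2) ⊛ f) ≈ const a ⊕ const (+ 2) ⊛ U f
U-affine a f = ≈-trans (U-⊕ _ _) (⊕-cong (U-const a) (U-const⊛ (+ 2) f))

UU-F₀ : U (U F₀) ≈ φ ⊕ const (+ 4) ⊛ (φ ⊛ (S ⊛ ⟦ conₚ 1ℤ ⟧ S))
UU-F₀ = begin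
  U (U F₀)                                     ≈⟨ ≈-trans (U-cong U-F₀) (U-V⊛ φ _) ⟩
  φ ⊛ U (1# ⊕ const (+ 2) ⊛ R)                 ≈⟨ ⊛-congˡ (≈-trans (U-affine 1ℤ R) (⊕-congˡ (⊛-congˡ U-R))) ⟩
  φ ⊛ (1# ⊕ const (+ 2) ⊛ (const (+ 2) ⊛ S))
    ≈⟨ solve 2 (λ x s → x :* (con 1ℤ :+ con (+ 2) :* (con (+ 2) :* s)) := x :+ con (+ 4) :* (x :* (s :* con 1ℤ))) ≈-refl φ S ⟩
  φ ⊕ const (+ 4) ⊛ (φ ⊛ (S ⊛ const 1ℤ))       ∎
  where open ≈-Reasoning

UUO-F₀ : ∃[ a ] ∃[ z ] U (U (O F₀)) ≈ const a ⊛ ψ ⊕ const (+ 1024) ⊛ z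
UUO-F₀ = + 6 , ψ ⊛ ((β ⊕ const (+ 4) ⊛ (β ⊛ β)) ⊛ (1# ⊕ S)) , (begin
  U (U (O F₀))
    ≈⟨ U-cong (≈-trans (U-cong O-F₀) (≈-trans (U-const⊛ (+ 2) _) (⊛-congˡ (≈-trans (U-V⊛ (V ψ) _)
         (⊛-congˡ (≈-trans (U-affine (+ 3) R) (⊕-congˡ (⊛-congˡ U-R)))))))) ⟩
  U (const (+ 2) ⊛ (V ψ ⊛ (const (+ 3) ⊕ const (+ 2) ⊛ (const (+ 2) ⊛ S))))
    ≈⟨ ≈-trans (U-const⊛ (+ 2) _) (⊛-congˡ (≈-trans (U-V⊛ ψ _)
         (⊛-congˡ (≈-trans (U-affine (+ 3) _) (⊕-congˡ (⊛-congˡ (≈-trans (U-const⊛ (+ 2) S) (⊛-congˡ U-S)))))))) ⟩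
  const (+ 2) ⊛ (ψ ⊛ (const (+ 3) ⊕ const (+ 2) ⊛ (const (+ 2) ⊛ (const (+ 8) ⊛ (S ⊛ (1# ⊕ S))))))
    ≈⟨ combine ((const (+ 64) ⊛ (ψ ⊛ (1# ⊕ S))) ∙ S≈16)
        (solve 3 (λ e s s′ →
          con (+ 2) :* (e :* (con (+ 3) :+ con (+ 2) :* (con (+ 2) :* (con (+ 8) :* (s :* (con 1ℤ :+ s))))))
            :- (con (+ 6) :* e :+ con (+ 1024) :* (e :* (s′ :* (con 1ℤ :+ s))))
          := (con (+ 64) :* (e :* (con 1ℤ :+ s))) :* (s :- con (+ 16) :* s′))
         ≈-refl ψ S (β ⊕ const (+ 4) ⊛ (β ⊛ β))) ⟩
  const (+ 6) ⊛ ψ ⊕ const (+ 1024) ⊛ (ψ ⊛ ((β ⊕ const (+ 4) ⊛ (β ⊛ β)) ⊛ (1# ⊕ S))) ∎)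
  where open ≈-Reasoning

F[_] : ℕ → Series
F[ zero ]  = F₀
F[ suc α ] = U (U F[ α ])

F[suc] : ∀ α → ∃[ p ] F[ suc α ] ≈ φ ⊕ const (+ (4 * 8 ^ α)) ⊛ (φ ⊛ (S ⊛ ⟦ p ⟧ S))
F[suc] zero    = conₚ 1ℤ , UU-F₀
F[suc] (suc α) with F[suc] α
... | p , Fα with UU-φSℤ[S] p
...   | p′ , eq = p′ , (begin
  U (U F[ suc α ])
    ≈⟨ U-cong (≈-trans (U-cong Fα) (≈-trans (U-⊕ _ _) (⊕-cong U-φ (U-const⊛ (+ (4 * 8 ^ α)) _)))) ⟩
  U (V φ ⊕ const (+ (4 * 8 ^ α)) ⊛ U (φ ⊛ (S ⊛ ⟦ p ⟧ S)))
    ≈⟨ ≈-trans (U-⊕ _ _) (⊕-cong (U-V φ) (≈-trans (U-const⊛ (+ (4 * 8 ^ α)) _) (⊛-congˡ eq))) ⟩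
  φ ⊕ const (+ (4 * 8 ^ α)) ⊛ (const (+ 8) ⊛ (φ ⊛ (S ⊛ ⟦ p′ ⟧ S)))
    ≈⟨ combine ((⊝ (φ ⊛ (S ⊛ ⟦ p′ ⟧ S))) ∙ ×8)
        (solve 4 (λ x k k′ w → x :+ k :* (con (+ 8) :* w) :- (x :+ k′ :* w) := (:- w) :* (k′ :- k :* con (+ 8)))
         ≈-refl φ (const (+ (4 * 8 ^ α))) (const (+ (4 * 8 ^ suc α))) (φ ⊛ (S ⊛ ⟦ p′ ⟧ S))) ⟩
  φ ⊕ const (+ (4 * 8 ^ suc α)) ⊛ (φ ⊛ (S ⊛ ⟦ p′ ⟧ S)) ∎)
  where
  open ≈-Reasoning
  lemma : ∀ k → 4 * (8 * k) ≡ 4 * k * 8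
  lemma = ℕ-Solver.solve-∀
  ×8 : const (+ (4 * 8 ^ suc α)) ≈ const (+ (4 * 8 ^ α)) ⊛ const (+ 8)
  ×8 = ≈-trans (≈-reflexive (cong const (trans (cong +_ (lemma (8 ^ α))) (ℤ.pos-* (4 * 8 ^ α) 8)))) (const-* _ _)

UUO-φ : U (U (O φ)) ≈ const (+ 2) ⊛ ψ
UUO-φ = ≈-trans (U-cong (≈-trans (U-cong O-φ) (≈-trans (U-const⊛ (+ 2) _) (⊛-congˡ (U-V (V ψ))))))
  (≈-trans (U-const⊛ (+ 2) _) (⊛-congˡ (U-V ψ)))

UUO-F[_] : ∀ α → ∃[ a ] ∃[ z ] U (U (O F[ α ])) ≈ const a ⊛ ψ ⊕ const (+ (2 ^ (3 * α + 10))) ⊛ z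
UUO-F[ zero ] = UUO-F₀
UUO-F[ suc α ] with F[suc] α
... | p , Fα with UUO-φSℤ[S] p
...   | a , z , eq = + 2 ℤ.+ K ℤ.* a , z , (begin
  U (U (O F[ suc α ]))
    ≈⟨ U-cong (U-cong (≈-trans (O-cong Fα) (≈-trans (O-⊕ _ _) (⊕-congˡ (O-const⊛ K _))))) ⟩
  U (U (O φ ⊕ const K ⊛ O w))
    ≈⟨ ≈-trans (U-cong (≈-trans (U-⊕ _ _) (⊕-congˡ (U-const⊛ K _)))) (≈-trans (U-⊕ _ _) (⊕-cong UUO-φ (≈-trans (U-const⊛ K _) (⊛-congˡ eq)))) ⟩
  const (+ 2) ⊛ ψ ⊕ const K ⊛ (const a ⊛ ψ ⊕ const (+ 2048) ⊛ z)
    ≈⟨ combine ((⊝ ψ) ∙ const-⊕ (+ 2) (K ℤ.* a) ⊞ (⊝ ψ) ∙ const-* K a ⊞ (⊝ z) ∙ ×2048)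
        (solve 7 (λ e k a s t z m →
          con (+ 2) :* e :+ k :* (a :* e :+ con (+ 2048) :* z) :- (s :* e :+ m :* z)
          := (:- e) :* (s :- (con (+ 2) :+ t)) :+ ((:- e) :* (t :- k :* a) :+ (:- z) :* (m :- k :* con (+ 2048))))
         ≈-refl ψ (const K) (const a) (const (+ 2 ℤ.+ K ℤ.* a)) (const (K ℤ.* a)) z (const (+ (2 ^ (3 * suc α + 10))))) ⟩
  const (+ 2 ℤ.+ K ℤ.* a) ⊛ ψ ⊕ const (+ (2 ^ (3 * suc α + 10))) ⊛ z ∎)
  where
  open ≈-Reasoning
  K = + (4 * 8 ^ α)
  w = φ ⊛ (S ⊛ ⟦ p ⟧ S)
  lemma : ∀ k → 8 * k * 1024 ≡ 4 * k * 2048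
  lemma = ℕ-Solver.solve-∀
  powers : 2 ^ (3 * suc α + 10) ≡ 4 * 8 ^ α * 2048
  powers = trans (ℕ.^-distribˡ-+-* 2 (3 * suc α) 10)
    (trans (cong (_* 1024) (sym (ℕ.^-*-assoc 2 3 (suc α)))) (lemma (8 ^ α)))
  ×2048 : const (+ (2 ^ (3 * suc α + 10))) ≈ const K ⊛ const (+ 2048)
  ×2048 = ≈-trans (≈-reflexive (cong const (trans (cong +_ powers) (ℤ.pos-* (4 * 8 ^ α) 2048)))) (const-* _ _)

F-coeff : ∀ n → F (suc n) ≡ + 2 ℤ.* v₀ (2 * suc n)
F-coeff n = trans (⊕-coeff (const (+ 2) ⊛ U v₀) (⊝ 1#) (suc n))
  (trans (cong₂ ℤ._+_ (trans (const⊛-coeff (+ 2) (U v₀) (suc n)) (cong (λ k → + 2 ℤ.* k) (U-coeff v₀ (suc n))))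
    (trans (⊝-coeff 1# (suc n)) (cong ℤ.-_ (1#-suc n)))) (ℤ.+-identityʳ _))

F[]-coeff : ∀ α m → F[ α ] m ≡ F₀ (4 ^ α * m)
F[]-coeff zero    m = cong F₀ (sym (ℕ.*-identityˡ m))
F[]-coeff (suc α) m = trans (trans (U-coeff _ m) (U-coeff _ (2 * m)))
  (trans (F[]-coeff α (2 * (2 * m))) (cong F₀ (lemma (4 ^ α) m)))
  where
  lemma : ∀ k m → k * (2 * (2 * m)) ≡ 4 * k * m
  lemma = ℕ-Solver.solve-∀

-- Divisibility

v₀-divisible : ∀ α n → ψ n ≡ 0ℤ → + (2 ^ (3 * α + 9)) ∣ v₀ (2 * (2 * (4 ^ α * suc (2 * (2 * (2 * n))))))
v₀-divisible α n ψn≡0 with UUO-F[ α ]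
... | a , z , eq = divides ℤ.∣ z n ∣ (ℕ.*-cancelˡ-≡ ℤ.∣ v₀ N ∣ (ℤ.∣ z n ∣ * 2 ^ (3 * α + 9)) 2
  (trans (sym (ℤ.abs-* (+ 2) (v₀ N))) (trans (cong ℤ.∣_∣ 2v₀≡) (trans (ℤ.abs-* (+ (2 ^ (3 * α + 10))) (z n)) powers))))
  where
  M = suc (2 * (2 * (2 * n)))
  N = 2 * (2 * (4 ^ α * M))
  F₀-coeff : F₀ (4 ^ α * M) ≡ + 2 ℤ.* v₀ N
  F₀-coeff = trans (U-coeff F (4 ^ α * M)) (positive (2 * (4 ^ α * M))
    (ℕ.m*n≢0 2 (4 ^ α * M) {{_}} {{ℕ.m*n≢0 (4 ^ α) M {{ℕ.m^n≢0 4 α}}}}))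
    where
    positive : ∀ m → NonZero m → F m ≡ + 2 ℤ.* v₀ (2 * m)
    positive (suc m) _ = F-coeff m
  2v₀≡ : + 2 ℤ.* v₀ N ≡ + (2 ^ (3 * α + 10)) ℤ.* z n
  2v₀≡ = begin
    + 2 ℤ.* v₀ N                      ≡⟨ F₀-coeff ⟨
    F₀ (4 ^ α * M)                    ≡⟨ F[]-coeff α M ⟨
    F[ α ] M                          ≡⟨ trans (U-coeff _ n) (trans (U-coeff _ (2 * n)) (O-coeff _ (2 * (2 * n)))) ⟨
    U (U (O F[ α ])) n                ≡⟨ coeff eq n ⟩
    (const a ⊛ ψ ⊕ const (+ (2 ^ (3 * α + 10))) ⊛ z) n
      ≡⟨ trans (⊕-coeff _ _ n) (cong₂ ℤ._+_ (trans (const⊛-coeff a ψ n) (trans (cong (a ℤ.*_) ψn≡0) (ℤ.*-zeroʳ a)))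
                                  (const⊛-coeff _ z n)) ⟩
    0ℤ ℤ.+ + (2 ^ (3 * α + 10)) ℤ.* z n ≡⟨ ℤ.+-identityˡ _ ⟩
    + (2 ^ (3 * α + 10)) ℤ.* z n      ∎
    where open ≡-Reasoning
  lemma : ∀ e k → 2 * e * k ≡ 2 * (k * e)
  lemma = ℕ-Solver.solve-∀
  powers : 2 ^ (3 * α + 10) * ℤ.∣ z n ∣ ≡ 2 * (ℤ.∣ z n ∣ * 2 ^ (3 * α + 9))
  powers = trans (cong (λ e → 2 ^ e * ℤ.∣ z n ∣) (ℕ.+-suc (3 * α) 9)) (lemma (2 ^ (3 * α + 9)) ℤ.∣ z n ∣)

Nonsquare≡1[8] : ℕ → Set
Nonsquare≡1[8] m = (∃[ n ] m ≡ suc (2 * (2 * (2 * n)))) × (∀ k → k * k ≢ m)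

nonsquare-8n+1 : ∀ n → ¬ (∃[ k ] n ≡ k * (k + 1) / 2) → Nonsquare≡1[8] (8 * n + 1)
nonsquare-8n+1 n ¬triangular = (n , lemma₁ n) , nonsquare
  where
  lemma₁ : ∀ n → 8 * n + 1 ≡ suc (2 * (2 * (2 * n)))
  lemma₁ = ℕ-Solver.solve-∀
  lemma₂ : ∀ j → suc (2 * j) * suc (2 * j) ≡ suc (2 * (2 * (j * (j + 1))))
  lemma₂ = ℕ-Solver.solve-∀
  nonsquare : ∀ k → k * k ≢ 8 * n + 1
  nonsquare k k²≡ with parity k
  ... | even j = ℕ.even≢odd (j * (2 * j)) (2 * (2 * n)) (trans (sym (ℕ.*-assoc 2 j (2 * j))) (trans k²≡ (lemma₁ n)))
  ... | odd j  = ¬triangular (j , sym (trans (cong (_/ 2) j[j+1]≡n*2) (m*n/n≡m n 2)))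
    where
    j[j+1]≡n*2 : j * (j + 1) ≡ n * 2
    j[j+1]≡n*2 = trans (ℕ.*-cancelˡ-≡ (j * (j + 1)) (2 * n) 2 (ℕ.*-cancelˡ-≡ (2 * (j * (j + 1))) (2 * (2 * n)) 2
      (ℕ.suc-injective (trans (sym (lemma₂ j)) (trans k²≡ (lemma₁ n)))))) (ℕ.*-comm 2 n)

module _ {p : ℕ} (p-prime : Prime p) (3≤p : 3 ≤ p) where

  p²≡1[8] : ∃[ t ] p * p ≡ suc (2 * (2 * (2 * t)))
  p²≡1[8] with parity p
  ... | even k with prime⇒irreducible p-prime (ℕ.m∣m*n {2} k)
  ...   | inj₂ 2≡p = ⊥-elim (ℕ.<⇒≢ 3≤p 2≡p)
  p²≡1[8] | odd k with pronic-even k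
  ... | t , eq = t , trans (lemma k) (cong (λ m → suc (2 * (2 * m))) eq)
    where
    lemma : ∀ j → suc (2 * j) * suc (2 * j) ≡ suc (2 * (2 * (j * suc j)))
    lemma = ℕ-Solver.solve-∀

  p²*nonsquare : ∀ {m} → Nonsquare≡1[8] m → Nonsquare≡1[8] (p * p * m)
  p²*nonsquare {m} ((n , m≡) , nonsquare) with p²≡1[8]
  ... | t , p²≡ = (8 * t * n + t + n , trans (cong₂ _*_ p²≡ m≡) (lemma t n)) , nonsquare′
    where
    lemma : ∀ t n → suc (2 * (2 * (2 * t))) * suc (2 * (2 * (2 * n))) ≡ suc (2 * (2 * (2 * (8 * t * n + t + n))))
    lemma = ℕ-Solver.solve-∀
    instance _ = prime⇒nonZero p-prime
    nonsquare″ : ∀ {k} → p ℕ.∣ k → k * k ≢ p * p * m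
    nonsquare″ (divides-refl r) k²≡ = nonsquare r (ℕ.*-cancelˡ-≡ (r * r) m (p * p) {{ℕ.m*n≢0 p p}}
      (trans (lemma′ p r) k²≡))
      where
      lemma′ : ∀ p r → p * p * (r * r) ≡ r * p * (r * p)
      lemma′ = ℕ-Solver.solve-∀
    nonsquare′ : ∀ k → k * k ≢ p * p * m
    nonsquare′ k k²≡ with euclidsLemma k k p-prime (divides (p * m) (trans k²≡ (lemma′ p m)))
      where
      lemma′ : ∀ p m → p * p * m ≡ p * m * p
      lemma′ = ℕ-Solver.solve-∀
    ... | inj₁ p∣k = nonsquare″ p∣k k²≡
    ... | inj₂ p∣k = nonsquare″ p∣k k²≡

  p^2β*nonsquare : ∀ β {m} → Nonsquare≡1[8] m → Nonsquare≡1[8] (p ^ (2 * β) * m)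
  p^2β*nonsquare zero    {m} sq = subst Nonsquare≡1[8] (sym (ℕ.*-identityˡ m)) sq
  p^2β*nonsquare (suc β) {m} sq = subst Nonsquare≡1[8]
    (trans (lemma p (p ^ (2 * β)) m) (cong (λ e → p ^ e * m) (sym (ℕ.*-suc 2 β))))
    (p²*nonsquare (p^2β*nonsquare β sq))
    where
    lemma : ∀ p e m → p * p * (e * m) ≡ p * (p * e) * m
    lemma = ℕ-Solver.solve-∀

theorem1p3 : (n : ℕ) → ¬ (∃[ k ] n ≡ k * (k + 1) / 2) →
    (α β p : ℕ) → Prime p → 3 ≤ p →
    + (2 ^ (3 * α + 9)) ∣ v₀ (2 ^ (2 * α + 2) * p ^ (2 * β) * (8 * n + 1))
theorem1p3 n ¬triangular α β p p-prime 3≤p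
  with p^2β*nonsquare p-prime 3≤p β (nonsquare-8n+1 n ¬triangular)
... | (n′ , m≡) , nonsquare = subst (λ N → + (2 ^ (3 * α + 9)) ∣ v₀ N) index (v₀-divisible α n′ ψn′≡0)
  where
  open ≡-Reasoning
  m = p ^ (2 * β) * (8 * n + 1)
  ψn′≡0 : ψ n′ ≡ 0ℤ
  ψn′≡0 = trans (ψ-coeff n′) (χ-nonsquare λ k k²≡ → nonsquare k (trans k²≡ (sym m≡)))
  lemma : ∀ e m → 2 * (2 * (e * m)) ≡ e * 4 * m
  lemma = ℕ-Solver.solve-∀
  index : 2 * (2 * (4 ^ α * suc (2 * (2 * (2 * n′))))) ≡ 2 ^ (2 * α + 2) * p ^ (2 * β) * (8 * n + 1)
  index = begin
    2 * (2 * (4 ^ α * suc (2 * (2 * (2 * n′)))))  ≡⟨ cong (λ m → 2 * (2 * (4 ^ α * m))) m≡ ⟨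
    2 * (2 * (4 ^ α * m))                         ≡⟨ lemma (4 ^ α) m ⟩
    4 ^ α * 4 * m                                 ≡⟨ cong (λ e → e * 4 * m) (ℕ.^-*-assoc 2 2 α) ⟩
    2 ^ (2 * α) * 4 * m                           ≡⟨ cong (_* m) (ℕ.^-distribˡ-+-* 2 (2 * α) 2) ⟨
    2 ^ (2 * α + 2) * m                           ≡⟨ ℕ.*-assoc (2 ^ (2 * α + 2)) (p ^ (2 * β)) (8 * n + 1) ⟨
    2 ^ (2 * α + 2) * p ^ (2 * β) * (8 * n + 1)   ∎
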